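{- Every $0$-bend apRAC graph with $n$ vertices has at most $4n-\sqrt{n}-6$ edges. Moreover, there is an infinite family of graphs, each of which (having $n$ vertices) has $4n-2\lfloor\sqrt{n}\rfloor-7$ edges and admits a $0$-bend apRAC drawing.
   Context: Graphs are finite and simple. A $k$-bend drawing of a graph maps vertices to distinct points of the plane and each edge to a polyline (a sequence of straight-line segments, called edge-segments) with at most $k$ bends connecting its endpoints and not passing through other vertices. A $k$-bend RAC drawing is a $k$-bend drawing in which any two crossing edge-segments cross at a right angle. A $k$-bend apRAC (axis-parallel RAC) drawing is a $k$-bend RAC drawing in which every edge-segment involved in a crossing is axis-parallel, i.e. every crossing is between a horizontal and a vertical edge-segment. A graph is $k$-bend apRAC if it admits a $k$-bend apRAC drawing; "$0$-bend" means straight-line.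
   Formalization: The upper bound is stated for n ≥ 3 only, since it fails for smaller n: the single edge on n = 2 vertices has 1 > 8 − √2 − 6 edges, and for n = 0 or 1 the bound is negative. -}

module Defs where

open import Data.Nat as ℕ using (ℕ; zero; suc)
open import Data.Fin as Fin using (Fin)
open import Data.Product using (Σ; ∃; _×_; _,_; proj₁; proj₂)
open import Data.Sum using (_⊎_)
open import Data.List using (List; length)
open import Data.List.Membership.Propositional using (_∈_)
open import Data.List.Relation.Unary.All using (All)
open import Data.List.Relation.Unary.Unique.Propositional using (Unique)
open import Relation.Binary.PropositionalEquality using (_≡_; _≢_)
open import Relation.Binary.Definitions using (Trichotomous)
open import Relation.Nullary using (¬_)
open import Function.Definitions using (Injective)

-- The real numbers, axiomatised as a (Dedekind-)complete ordered field.
-- Any two such structures are isomorphic, so quantifying over all of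
-- them is the same as talking about ℝ.

record Reals : Set₁ where
  infixl 6 _+_ _-_
  infixl 7 _*_
  infix 4 _<_ _≤_
  field
    R    : Set
    0r   : R
    1r   : R
    _+_  : R → R → R
    _*_  : R → R → R
    -_   : R → R
    _<_  : R → R → Set
    +-assoc   : ∀ x y z → (x + y) + z ≡ x + (y + z)
    +-comm    : ∀ x y → x + y ≡ y + x
    +-idʳ     : ∀ x → x + 0r ≡ x
    +-invʳ    : ∀ x → x + (- x) ≡ 0r
    *-assoc   : ∀ x y z → (x * y) * z ≡ x * (y * z)
    *-comm    : ∀ x y → x * y ≡ y * x
    *-idʳ     : ∀ x → x * 1r ≡ x
    distribˡ  : ∀ x y z → x * (y + z) ≡ x * y + x * z
    0≢1       : 0r ≢ 1r
    *-inv     : ∀ x → x ≢ 0r → Σ R λ y → x * y ≡ 1r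
    <-trans   : ∀ {x y z} → x < y → y < z → x < z
    <-tri     : Trichotomous _≡_ _<_
    +-mono-<  : ∀ {x y} z → x < y → x + z < y + z
    *-pos     : ∀ {x y} → 0r < x → 0r < y → 0r < x * y
    sup       : (P : R → Set) → (Σ R P) →
                (Σ R λ b → ∀ x → P x → ¬ (b < x)) →
                Σ R λ s → (∀ x → P x → ¬ (s < x)) ×
                          (∀ b → (∀ x → P x → ¬ (b < x)) → ¬ (b < s))

  _-_ : R → R → R
  x - y = x + (- y)

  _≤_ : R → R → Set
  x ≤ y = ¬ (y < x)

record Graph (n : ℕ) : Set where
  field
    edges   : List (Fin n × Fin n)
    ordered : All (λ e → proj₁ e Fin.< proj₂ e) edges
    unique  : Unique edges

numEdges : ∀ {n} → Graph n → ℕ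
numEdges G = length (Graph.edges G)

module Geometry (ℝ : Reals) where
  open Reals ℝ

  Point : Set
  Point = R × R

  x-of y-of : Point → R
  x-of = proj₁
  y-of = proj₂

  OnClosedSeg : Point → Point → Point → Set
  OnClosedSeg p a b = Σ R λ t → (0r ≤ t) × (t ≤ 1r) ×
    (x-of p ≡ x-of a + t * (x-of b - x-of a)) ×
    (y-of p ≡ y-of a + t * (y-of b - y-of a))

  OnOpenSeg : Point → Point → Point → Set
  OnOpenSeg p a b = Σ R λ t → (0r < t) × (t < 1r) ×
    (x-of p ≡ x-of a + t * (x-of b - x-of a)) ×
    (y-of p ≡ y-of a + t * (y-of b - y-of a))

  SegsCross : Point → Point → Point → Point → Set
  SegsCross a b c d = Σ Point λ p → OnOpenSeg p a b × OnOpenSeg p c d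

  Horizontal Vertical : Point → Point → Set
  Horizontal a b = y-of a ≡ y-of b
  Vertical   a b = x-of a ≡ x-of b

  Perpendicular : Point → Point → Point → Point → Set
  Perpendicular a b c d =
    (x-of b - x-of a) * (x-of d - x-of c) + (y-of b - y-of a) * (y-of d - y-of c) ≡ 0r

  record Drawing0 {n : ℕ} (G : Graph n) : Set where
    field
      pos       : Fin n → Point
      pos-inj   : Injective _≡_ _≡_ pos
      no-pass   : ∀ {i j} → (i , j) ∈ Graph.edges G → ∀ k → k ≢ i → k ≢ j →
                  ¬ OnClosedSeg (pos k) (pos i) (pos j)

  module _ {n : ℕ} {G : Graph n} (D : Drawing0 G) where
    open Drawing0 D

    EdgesCross : (Fin n × Fin n) → (Fin n × Fin n) → Set
    EdgesCross (i , j) (k , l) = SegsCross (pos i) (pos j) (pos k) (pos l)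

    IsRAC : Set
    IsRAC = ∀ {e f} → e ∈ Graph.edges G → f ∈ Graph.edges G → e ≢ f →
            EdgesCross e f →
            Perpendicular (pos (proj₁ e)) (pos (proj₂ e)) (pos (proj₁ f)) (pos (proj₂ f))

    IsAxisParallelCrossings : Set
    IsAxisParallelCrossings = ∀ {e f} → e ∈ Graph.edges G → f ∈ Graph.edges G → e ≢ f →
      EdgesCross e f →
      (Horizontal (pos (proj₁ e)) (pos (proj₂ e)) × Vertical (pos (proj₁ f)) (pos (proj₂ f)))
      ⊎ (Vertical (pos (proj₁ e)) (pos (proj₂ e)) × Horizontal (pos (proj₁ f)) (pos (proj₂ f)))

    IsApRAC : Set
    IsApRAC = IsRAC × IsAxisParallelCrossings

  ZeroBendApRAC : ∀ {n} → Graph n → Set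
  ZeroBendApRAC G = Σ (Drawing0 G) IsApRAC

-- m ≤ 4n - √n - 6   ⇔   m + 6 ≤ 4n  and  n ≤ (4n - 6 - m)²
AtMost4n-√n-6 : ℕ → ℕ → Set
AtMost4n-√n-6 m n = (m ℕ.+ 6 ℕ.≤ 4 ℕ.* n) ×
  (n ℕ.≤ (4 ℕ.* n ℕ.∸ 6 ℕ.∸ m) ℕ.* (4 ℕ.* n ℕ.∸ 6 ℕ.∸ m))

IsFloorSqrt : ℕ → ℕ → Set
IsFloorSqrt s n = (s ℕ.* s ℕ.≤ n) × (n ℕ.< suc s ℕ.* suc s)

{-# OPTIONS --safe #-}
-- Upper bound. The non-vertical edges of a 0-bend apRAC drawing do not cross, and the vertical
-- edges number at most n minus the number of columns, because the top vertex of a column is not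
-- the lower end of a vertical edge. Planarity therefore gives m ≤ (3n - 6) + (n - #columns), and
-- symmetrically with rows; as n ≤ #columns · #rows, one of the two numbers is at least √n.
--
-- The bound 3n - 6 comes from a charging argument rather than Euler's formula. After a shear all
-- abscissae differ. Each edge is charged injectively to a pair of a vertex and one of three slots:
-- the steepest edge leaving i to the right is charged to i, and any other edge i j to the leftmost
-- vertex w of the wedge between i j and the next steeper edge i k, in a slot telling whether
-- i j is the edge directly below w or w = j and i k is the edge directly above w. Six of the 3n
-- pairs are never used: five at the leftmost and rightmost vertices, and one at the vertex
-- farthest from the line joining them.
--
-- Lower bound. Rotate the king's graph on an s × s grid by 45°: only the diagonals of a cell cross,
-- and they become axis-parallel. Two further vertices, each seeing two sides of the grid, are
-- joined to these sides and to each other, for n = s² + 2 vertices and 4n - 2s - 7 edges.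
module Submission where

open import Defs
open import Algebra.Bundles using (CommutativeRing)
import Algebra.Properties.Ring
import Algebra.Properties.Semiring.Mult.TCOptimised
import Algebra.Solver.Ring
open import Algebra.Solver.Ring.AlmostCommutativeRing using (AlmostCommutativeRing; fromCommutativeRing; _-Raw-AlmostCommutative⟶_)
open import Data.Bool using (Bool; true; false)
open import Data.Empty using (⊥; ⊥-elim)
open import Data.Fin as Fin using (Fin; zero; suc; toℕ; inject₁)
import Data.Fin.Properties as FinP
open import Data.Integer as ℤ using (ℤ; -[1+_]; _⊖_)
import Data.Integer.Properties as ℤP
open import Data.List using (List; []; _∷_; length; map; filter; lookup; allFin; tabulate)
import Data.List.Membership.DecPropositional as DecMembership
open import Data.List.Membership.Propositional using (_∈_; _∉_)
open import Data.List.Membership.Propositional.Properties using (∈-lookup; ∈-filter⁺; ∈-filter⁻; ∈-map⁻; ∈-allFin; ∈-tabulate⁻)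
open import Data.List.Properties using (length-map; length-tabulate)
open import Data.List.Relation.Unary.All as All using (All; []; _∷_)
import Data.List.Relation.Unary.All.Properties as AllP
open import Data.List.Relation.Unary.AllPairs using ([]; _∷_)
open import Data.List.Relation.Unary.Any as Any using (here; there)
open import Data.List.Relation.Unary.Any.Properties using (lookup-index)
open import Data.List.Relation.Unary.Unique.Propositional using (Unique)
open import Data.List.Relation.Unary.Unique.Propositional.Properties using (filter⁺; allFin⁺; tabulate⁺)
open import Data.Maybe using (Maybe; just; nothing)
open import Data.Nat as ℕ using (ℕ; zero; suc; z≤n; s≤s)
import Data.Nat.Properties as ℕP
open import Data.Nat.Solver using (module +-*-Solver)
open import Data.Product using (Σ; ∃; _×_; _,_; proj₁; proj₂; uncurry)
open import Data.Product.Properties using (≡-dec)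
open import Data.Sum as Sum using (_⊎_; inj₁; inj₂; [_,_]′)
open import Data.Sum.Function.Propositional using (_⊎-↔_)
open import Data.Unit using (⊤; tt)
open import Function.Bundles using (_↔_; Inverse)
open import Function.Construct.Composition using (_↔-∘_)
open import Function.Construct.Identity using (↔-id)
open import Function.Definitions using (Injective)
open import Level using (0ℓ)
open import Relation.Binary.Definitions using (tri<; tri≈; tri>; DecidableEquality)
import Relation.Binary.Definitions as Binary
open import Relation.Binary.PropositionalEquality using (_≡_; _≢_; refl; sym; trans; cong; cong₂; subst; subst₂; isEquivalence; module ≡-Reasoning)
open import Relation.Nullary using (¬_; Dec; yes; no; ¬?)
open import Relation.Nullary.Decidable using (_×-dec_; _⊎-dec_; _→-dec_)
open import Relation.Unary using (Decidable)

-- Ring identities in the axiomatised field.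

module RingSolver (ℝ : Reals) where
  open Reals ℝ

  +-*-commutativeRing : CommutativeRing 0ℓ 0ℓ
  +-*-commutativeRing = record
    { _+_ = _+_ ; _*_ = _*_ ; -_ = λ z → - z ; 0# = 0r ; 1# = 1r
    ; isCommutativeRing = record
      { isRing = record
        { +-isAbelianGroup = record
          { isGroup = record
            { isMonoid = record
              { isSemigroup = record
                { isMagma = record { isEquivalence = isEquivalence ; ∙-cong = cong₂ _+_ }
                ; assoc = +-assoc }
              ; identity = (λ x → trans (+-comm 0r x) (+-idʳ x)) , +-idʳ }
            ; inverse = (λ x → trans (+-comm (- x) x) (+-invʳ x)) , +-invʳ
            ; ⁻¹-cong = cong (λ z → - z) }
          ; comm = +-comm }
        ; *-cong = cong₂ _*_
        ; *-assoc = *-assoc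
        ; *-identity = (λ x → trans (*-comm 1r x) (*-idʳ x)) , *-idʳ
        ; distrib = distribˡ , λ x y z →
            trans (*-comm (y + z) x) (trans (distribˡ x y z) (cong₂ _+_ (*-comm x y) (*-comm x z))) }
      ; *-comm = *-comm } }

  private
    module CR = CommutativeRing +-*-commutativeRing
    module M = Algebra.Properties.Semiring.Mult.TCOptimised CR.semiring
    open Algebra.Properties.Ring CR.ring
      using (-‿distribˡ-*; -‿distribʳ-*; -0#≈0#; -‿involutive; -‿+-comm)

  fromℕ : ℕ → R
  fromℕ n = n M.× 1r

  fromℕ-suc : ∀ n → fromℕ (suc n) ≡ 1r + fromℕ n
  fromℕ-suc n = M.1+× n 1r

  fromℕ-+ : ∀ m n → fromℕ (m ℕ.+ n) ≡ fromℕ m + fromℕ n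
  fromℕ-+ = M.×-homo-+ 1r

  private
    -- Integers serve as the coefficients because the solver has to compare coefficients by
    -- computation, which equality in an axiomatised field does not allow.
    ⟦_⟧ℤ : ℤ → R
    ⟦ ℤ.+ n ⟧ℤ = fromℕ n
    ⟦ -[1+ n ] ⟧ℤ = - fromℕ (suc n)

    neg-homo : ∀ i → ⟦ ℤ.- i ⟧ℤ ≡ - ⟦ i ⟧ℤ
    neg-homo (ℤ.+ zero)    = sym -0#≈0#
    neg-homo (ℤ.+ (suc n)) = refl
    neg-homo -[1+ n ]      = sym (-‿involutive _)

    a-b≡[1+a]-[1+b] : ∀ a b → a - b ≡ (1r + a) - (1r + b)
    a-b≡[1+a]-[1+b] a b = sym (begin
      (1r + a) + - (1r + b)       ≡⟨ cong ((1r + a) +_) (sym (-‿+-comm 1r b)) ⟩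
      (1r + a) + (- 1r + - b)     ≡⟨ cong (_+ (- 1r + - b)) (+-comm 1r a) ⟩
      (a + 1r) + (- 1r + - b)     ≡⟨ +-assoc a 1r _ ⟩
      a + (1r + (- 1r + - b))     ≡⟨ cong (a +_) (sym (+-assoc 1r (- 1r) _)) ⟩
      a + ((1r + - 1r) + - b)     ≡⟨ cong (λ z → a + (z + - b)) (+-invʳ 1r) ⟩
      a + (0r + - b)              ≡⟨ cong (a +_) (CR.+-identityˡ _) ⟩
      a + - b                     ∎)
      where open ≡-Reasoning

    ⊖-homo : ∀ m n → ⟦ m ⊖ n ⟧ℤ ≡ fromℕ m - fromℕ n
    ⊖-homo zero    zero    = sym (+-invʳ 0r)
    ⊖-homo zero    (suc n) = sym (CR.+-identityˡ _)
    ⊖-homo (suc m) zero    = sym (trans (cong (fromℕ (suc m) +_) -0#≈0#) (+-idʳ _))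
    ⊖-homo (suc m) (suc n) = begin
      ⟦ suc m ⊖ suc n ⟧ℤ                 ≡⟨ cong ⟦_⟧ℤ (ℤP.[1+m]⊖[1+n]≡m⊖n m n) ⟩
      ⟦ m ⊖ n ⟧ℤ                         ≡⟨ ⊖-homo m n ⟩
      fromℕ m - fromℕ n                  ≡⟨ a-b≡[1+a]-[1+b] _ _ ⟩
      (1r + fromℕ m) - (1r + fromℕ n)    ≡⟨ cong₂ _-_ (sym (fromℕ-suc m)) (sym (fromℕ-suc n)) ⟩
      fromℕ (suc m) - fromℕ (suc n)      ∎
      where open ≡-Reasoning

    +-homo : ∀ i j → ⟦ i ℤ.+ j ⟧ℤ ≡ ⟦ i ⟧ℤ + ⟦ j ⟧ℤ
    +-homo (ℤ.+ m) (ℤ.+ n) = fromℕ-+ m n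
    +-homo (ℤ.+ m) -[1+ n ] = ⊖-homo m (suc n)
    +-homo -[1+ m ] (ℤ.+ n) = trans (⊖-homo n (suc m)) (+-comm _ _)
    +-homo -[1+ m ] -[1+ n ] = begin
      - fromℕ (suc (suc (m ℕ.+ n)))          ≡⟨ cong (λ k → - fromℕ k) (sym (ℕP.+-suc (suc m) n)) ⟩
      - fromℕ (suc m ℕ.+ suc n)              ≡⟨ cong (λ z → - z) (fromℕ-+ (suc m) (suc n)) ⟩
      - (fromℕ (suc m) + fromℕ (suc n))      ≡⟨ sym (-‿+-comm _ _) ⟩
      - fromℕ (suc m) + - fromℕ (suc n)      ∎
      where open ≡-Reasoning

    *-homo⁺ : ∀ m n → ⟦ ℤ.+ m ℤ.* ℤ.+ n ⟧ℤ ≡ fromℕ m * fromℕ n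
    *-homo⁺ m n = trans (cong ⟦_⟧ℤ (sym (ℤP.pos-* m n))) (M.×1-homo-* m n)

    *-homoˡ : ∀ m j → ⟦ ℤ.+ m ℤ.* j ⟧ℤ ≡ fromℕ m * ⟦ j ⟧ℤ
    *-homoˡ m (ℤ.+ n) = *-homo⁺ m n
    *-homoˡ m -[1+ n ] = begin
      ⟦ ℤ.+ m ℤ.* ℤ.- (ℤ.+ suc n) ⟧ℤ      ≡⟨ cong ⟦_⟧ℤ (sym (ℤP.neg-distribʳ-* (ℤ.+ m) (ℤ.+ suc n))) ⟩
      ⟦ ℤ.- (ℤ.+ m ℤ.* ℤ.+ suc n) ⟧ℤ      ≡⟨ neg-homo (ℤ.+ m ℤ.* ℤ.+ suc n) ⟩
      - ⟦ ℤ.+ m ℤ.* ℤ.+ suc n ⟧ℤ          ≡⟨ cong (λ z → - z) (*-homo⁺ m (suc n)) ⟩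
      - (fromℕ m * fromℕ (suc n))         ≡⟨ -‿distribʳ-* _ _ ⟩
      fromℕ m * - fromℕ (suc n)           ∎
      where open ≡-Reasoning

    *-homo : ∀ i j → ⟦ i ℤ.* j ⟧ℤ ≡ ⟦ i ⟧ℤ * ⟦ j ⟧ℤ
    *-homo (ℤ.+ m) j = *-homoˡ m j
    *-homo -[1+ m ] j = begin
      ⟦ ℤ.- (ℤ.+ suc m) ℤ.* j ⟧ℤ     ≡⟨ cong ⟦_⟧ℤ (sym (ℤP.neg-distribˡ-* (ℤ.+ suc m) j)) ⟩
      ⟦ ℤ.- (ℤ.+ suc m ℤ.* j) ⟧ℤ     ≡⟨ neg-homo (ℤ.+ suc m ℤ.* j) ⟩
      - ⟦ ℤ.+ suc m ℤ.* j ⟧ℤ         ≡⟨ cong (λ z → - z) (*-homoˡ (suc m) j) ⟩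
      - (fromℕ (suc m) * ⟦ j ⟧ℤ)     ≡⟨ -‿distribˡ-* _ _ ⟩
      - fromℕ (suc m) * ⟦ j ⟧ℤ       ∎
      where open ≡-Reasoning

    ring : AlmostCommutativeRing 0ℓ 0ℓ
    ring = fromCommutativeRing +-*-commutativeRing

    morphism : CommutativeRing.rawRing ℤP.+-*-commutativeRing -Raw-AlmostCommutative⟶ ring
    morphism = record
      { ⟦_⟧ = ⟦_⟧ℤ ; +-homo = +-homo ; *-homo = *-homo ; -‿homo = neg-homo
      ; 0-homo = refl ; 1-homo = refl }

    coeff≟ : ∀ i j → Maybe (⟦ i ⟧ℤ ≡ ⟦ j ⟧ℤ)
    coeff≟ i j with i ℤP.≟ j
    ... | yes i≡j = just (cong ⟦_⟧ℤ i≡j)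
    ... | no _    = nothing

  open Algebra.Solver.Ring (CommutativeRing.rawRing ℤP.+-*-commutativeRing) ring morphism coeff≟ public
    using (Polynomial; solve; _:+_; _:*_; _:-_; :-_; _:=_; con)

-- Order and inverses in the field.

module OrderedField (ℝ : Reals) where
  open Reals ℝ
  open RingSolver ℝ public

  :0 :1 : ∀ {n} → Polynomial n
  :0 = con (ℤ.+ 0)
  :1 = con (ℤ.+ 1)

  <-irrefl : ∀ {x} → ¬ (x < x)
  <-irrefl {x} x<x with <-tri x x
  ... | tri< _ ≢ _ = ≢ refl
  ... | tri≈ ¬< _ _ = ¬< x<x
  ... | tri> _ ≢ _ = ≢ refl

  <⇒≢ : ∀ {x y} → x < y → x ≢ y
  <⇒≢ x<y refl = <-irrefl x<y

  >⇒≢ : ∀ {x y} → y < x → x ≢ y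
  >⇒≢ y<x refl = <-irrefl y<x

  <⇒≤ : ∀ {x y} → x < y → x ≤ y
  <⇒≤ x<y y<x = <-irrefl (<-trans x<y y<x)

  ≤-refl : ∀ {x} → x ≤ x
  ≤-refl = <-irrefl

  ≡⇒≤ : ∀ {x y} → x ≡ y → x ≤ y
  ≡⇒≤ refl = ≤-refl

  ≤⇒<⊎≡ : ∀ {x y} → x ≤ y → x < y ⊎ x ≡ y
  ≤⇒<⊎≡ {x} {y} x≤y with <-tri x y
  ... | tri< x<y _ _ = inj₁ x<y
  ... | tri≈ _ x≡y _ = inj₂ x≡y
  ... | tri> _ _ y<x = ⊥-elim (x≤y y<x)

  ≤∧≢⇒< : ∀ {x y} → x ≤ y → x ≢ y → x < y
  ≤∧≢⇒< x≤y x≢y with ≤⇒<⊎≡ x≤y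
  ... | inj₁ x<y = x<y
  ... | inj₂ x≡y = ⊥-elim (x≢y x≡y)

  ≤-<-trans : ∀ {x y z} → x ≤ y → y < z → x < z
  ≤-<-trans x≤y y<z with ≤⇒<⊎≡ x≤y
  ... | inj₁ x<y = <-trans x<y y<z
  ... | inj₂ refl = y<z

  <-≤-trans : ∀ {x y z} → x < y → y ≤ z → x < z
  <-≤-trans x<y y≤z with ≤⇒<⊎≡ y≤z
  ... | inj₁ y<z = <-trans x<y y<z
  ... | inj₂ refl = x<y

  ≤-trans : ∀ {x y z} → x ≤ y → y ≤ z → x ≤ z
  ≤-trans x≤y y≤z z<x = y≤z (<-≤-trans z<x x≤y)

  ≤-antisym : ∀ {x y} → x ≤ y → y ≤ x → x ≡ y
  ≤-antisym x≤y y≤x with ≤⇒<⊎≡ x≤y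
  ... | inj₁ x<y = ⊥-elim (y≤x x<y)
  ... | inj₂ x≡y = x≡y

  _≟_ : DecidableEquality R
  x ≟ y with <-tri x y
  ... | tri< _ x≢y _ = no x≢y
  ... | tri≈ _ x≡y _ = yes x≡y
  ... | tri> _ x≢y _ = no x≢y

  _<?_ : Binary.Decidable _<_
  x <? y with <-tri x y
  ... | tri< x<y _ _ = yes x<y
  ... | tri≈ ¬< _ _ = no ¬<
  ... | tri> ¬< _ _ = no ¬<

  <⇒0<- : ∀ {x y} → x < y → 0r < y - x
  <⇒0<- {x} {y} x<y = subst (_< y - x) (+-invʳ x) (+-mono-< (- x) x<y)

  0<-⇒< : ∀ {x y} → 0r < y - x → x < y
  0<-⇒< {x} {y} p = subst₂ _<_ (solve 1 (λ x → :0 :+ x := x) refl x)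
                               (solve 2 (λ x y → y :- x :+ x := y) refl x y) (+-mono-< x p)

  -- Strict inequalities are proved by exhibiting the difference of the two sides as a positive quantity.
  0<⇒< : ∀ {x y p} → 0r < p → p ≡ y - x → x < y
  0<⇒< 0<p refl = 0<-⇒< 0<p

  +-pos : ∀ {x y} → 0r < x → 0r < y → 0r < x + y
  +-pos {x} {y} 0<x 0<y = <-trans 0<y (subst (_< x + y) (solve 1 (λ y → :0 :+ y := y) refl y) (+-mono-< y 0<x))

  0<1 : 0r < 1r
  0<1 with <-tri 0r 1r
  ... | tri< 0<1 _ _ = 0<1
  ... | tri≈ _ 0≡1 _ = ⊥-elim (0≢1 0≡1)
  ... | tri> _ _ 1<0 = ⊥-elim (<-irrefl (<-trans 1<0
          (0<⇒< (*-pos (<⇒0<- 1<0) (<⇒0<- 1<0)) (solve 0 ((:0 :- :1) :* (:0 :- :1) := :1 :- :0) refl))))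

  x-y≡0⇒x≡y : ∀ {x y} → x - y ≡ 0r → x ≡ y
  x-y≡0⇒x≡y {x} {y} eq = trans (solve 2 (λ x y → x := x :- y :+ y) refl x y)
    (trans (cong (_+ y) eq) (solve 1 (λ y → :0 :+ y := y) refl y))

  x≢y⇒x-y≢0 : ∀ {x y} → x ≢ y → x - y ≢ 0r
  x≢y⇒x-y≢0 x≢y eq = x≢y (x-y≡0⇒x≡y eq)

  -- Made total by the value `0r` at zero, so that slopes and ratios are plain functions; nonzero
  -- denominators are asked for only where `inv-*` is applied.
  inv : R → R
  inv x with x ≟ 0r
  ... | yes _ = 0r
  ... | no x≢0 = proj₁ (*-inv x x≢0)

  inv-* : ∀ {x} → x ≢ 0r → inv x * x ≡ 1r
  inv-* {x} x≢0 with x ≟ 0r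
  ... | yes x≡0 = ⊥-elim (x≢0 x≡0)
  ... | no x≢0′ = trans (*-comm _ x) (proj₂ (*-inv x x≢0′))

  inv-pos : ∀ {x} → 0r < x → 0r < inv x
  inv-pos {x} 0<x with <-tri 0r (inv x)
  ... | tri< p _ _ = p
  ... | tri≈ _ e _ = ⊥-elim (0≢1 (trans (trans (solve 1 (λ x → :0 := :0 :* x) refl x) (cong (_* x) e)) (inv-* (>⇒≢ 0<x))))
  ... | tri> _ _ p = ⊥-elim (<-irrefl (<-trans 0<1 (0<⇒< (*-pos (<⇒0<- p) 0<x)
         (trans (solve 2 (λ i x → (:0 :- i) :* x := :0 :- (i :* x)) refl (inv x) x) (cong (λ z → 0r - z) (inv-* (>⇒≢ 0<x)))))))

  +-mono-≤ : ∀ {x x′ y y′} → x ≤ x′ → y ≤ y′ → x + y ≤ x′ + y′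
  +-mono-≤ {x} {x′} {y} {y′} x≤x′ y≤y′ = ≤-trans (step y x≤x′)
    (subst₂ _≤_ (+-comm y x′) (+-comm y′ x′) (step x′ y≤y′))
    where
      step : ∀ {a b} c → a ≤ b → a + c ≤ b + c
      step c a≤b with ≤⇒<⊎≡ a≤b
      ... | inj₁ a<b  = <⇒≤ (+-mono-< c a<b)
      ... | inj₂ refl = ≤-refl

-- Counting lists by injections into finite sets.

lookup-injective : ∀ {A : Set} {xs : List A} → Unique xs → Injective _≡_ _≡_ (lookup xs)
lookup-injective (x∉ ∷ u) {zero}  {zero}  eq = refl
lookup-injective (x∉ ∷ u) {zero}  {suc j} eq = ⊥-elim (All.lookup x∉ (∈-lookup j) eq)
lookup-injective (x∉ ∷ u) {suc i} {zero}  eq = ⊥-elim (All.lookup x∉ (∈-lookup i) (sym eq))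
lookup-injective (x∉ ∷ u) {suc i} {suc j} eq = cong suc (lookup-injective u eq)

unique-length-≤ : ∀ {A : Set} {N} {code : A → Fin N} → Injective _≡_ _≡_ code →
                  {xs : List A} → Unique xs → length xs ℕ.≤ N
unique-length-≤ code-inj u = FinP.injective⇒≤ λ eq → lookup-injective u (code-inj eq)

module _ {A C : Set} (_∼_ : A → C → Set) (∼-injective : ∀ {a b c} → a ∼ c → b ∼ c → a ≡ b)
         {X : List C} (X-unique : Unique X) (X-missed : ∀ {a c} → a ∼ c → c ∉ X) where

  private
    -- The `All` component records the origin of every listed value; it is what shows the next
    -- chosen value to be new.
    values : ∀ {L} → Unique L → (∀ {a} → a ∈ L → ∃ (a ∼_)) →
             Σ (List C) λ cs → length cs ≡ length L ℕ.+ length X × Unique cs ×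
                               All (λ c → c ∈ X ⊎ (∃ λ a → a ∈ L × a ∼ c)) cs
    values [] _ = X , refl , X-unique , All.tabulate inj₁
    values {a ∷ L} (a∉L ∷ u) related =
      let c , a∼c = related (here refl)
          cs , len , u′ , from = values u (λ b∈L → related (there b∈L))
      in c ∷ cs , cong suc len ,
         All.map (λ { (inj₁ d∈X) refl → X-missed a∼c d∈X
                    ; (inj₂ (b , b∈L , b∼d)) refl → All.lookup a∉L b∈L (∼-injective a∼c b∼d) }) from ∷ u′ ,
         inj₂ (a , here refl , a∼c) ∷
         All.map (λ { (inj₁ d∈X) → inj₁ d∈X
                    ; (inj₂ (b , b∈L , b∼d)) → inj₂ (b , there b∈L , b∼d) }) from

  -- One value is chosen for every entry of `L`, and the list `X` is appended. Injectivity keeps the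
  -- chosen values apart and `X-missed` keeps them off `X`, so the pigeonhole principle applies to
  -- the whole list.
  length+missed≤ : ∀ {N} {code : C → Fin N} → Injective _≡_ _≡_ code →
                   ∀ {L} → Unique L → (∀ {a} → a ∈ L → ∃ (a ∼_)) → length L ℕ.+ length X ℕ.≤ N
  length+missed≤ code-inj u related =
    let cs , len , u′ , _ = values u related
    in subst (ℕ._≤ _) len (unique-length-≤ code-inj u′)

length-filter-split : ∀ {A : Set} {P Q : A → Set} (P? : Decidable P) (Q? : Decidable Q) →
  (∀ {a} → P a → ¬ Q a) → (∀ {a} → ¬ P a → Q a) →
  ∀ xs → length xs ≡ length (filter P? xs) ℕ.+ length (filter Q? xs)
length-filter-split P? Q? P⇒¬Q ¬P⇒Q [] = refl
length-filter-split P? Q? P⇒¬Q ¬P⇒Q (x ∷ xs) with ih ← length-filter-split P? Q? P⇒¬Q ¬P⇒Q xs | P? x | Q? x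
... | yes p | yes q = ⊥-elim (P⇒¬Q p q)
... | yes p | no _  = cong suc ih
... | no _  | yes q = trans (cong suc ih) (sym (ℕP.+-suc _ _))
... | no ¬p | no ¬q = ⊥-elim (¬q (¬P⇒Q ¬p))

-- Extrema over finite index sets.

module Extrema (ℝ : Reals) where
  open Reals ℝ
  open OrderedField ℝ

  abstract
    argmin : ∀ {n} {P : Fin n → Set} → Decidable P → (f : Fin n → R) → ∃ P →
             ∃ λ v → P v × (∀ w → P w → f v ≤ f w)
    argmin {suc n} {P} P? f (u , Pu) with FinP.any? (λ i → P? (suc i)) | P? zero
    ... | no ¬tail | no ¬P0 = ⊥-elim (absurd u Pu)
      where absurd : ∀ u → ¬ P u
            absurd zero    = ¬P0
            absurd (suc i) p = ¬tail (i , p)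
    ... | no ¬tail | yes P0 = zero , P0 , λ { zero _ → ≤-refl ; (suc i) p → ⊥-elim (¬tail (i , p)) }
    ... | yes tail | no ¬P0 =
      let v , Pv , min = argmin (λ i → P? (suc i)) (λ i → f (suc i)) tail
      in suc v , Pv , λ { zero p → ⊥-elim (¬P0 p) ; (suc i) p → min i p }
    ... | yes tail | yes P0 with argmin (λ i → P? (suc i)) (λ i → f (suc i)) tail
    ...   | v , Pv , min with f zero <? f (suc v)
    ...     | yes lt = zero , P0 , λ { zero _ → ≤-refl ; (suc i) p → ≤-trans (<⇒≤ lt) (min i p) }
    ...     | no ¬lt = suc v , Pv , λ { zero _ → ¬lt ; (suc i) p → min i p }

    argmax : ∀ {n} {P : Fin n → Set} → Decidable P → (f : Fin n → R) → ∃ P →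
             ∃ λ v → P v × (∀ w → P w → f w ≤ f v)
    argmax P? f p =
      let v , Pv , min = argmin P? (λ w → - f w) p
      in v , Pv , λ w Pw fv<fw → min w Pw (0<⇒< (<⇒0<- fv<fw)
           (solve 2 (λ a b → b :- a := (:- a) :- (:- b)) refl (f v) (f w)))

    upper-bound : ∀ {n} (f : Fin n → R) → ∃ λ B → ∀ i → f i ≤ B
    upper-bound {zero} f = 0r , λ ()
    upper-bound {suc n} f =
      let v , _ , max = argmax {P = λ _ → ⊤} (λ _ → yes tt) f (zero , tt) in f v , λ i → max i tt

-- Affine functions of one real variable.

module Lines (ℝ : Reals) where
  open Reals ℝ
  open OrderedField ℝ

  line : R → R → R → R → R
  line a c s X = c + s * (X - a)

  line-at-base : ∀ a c s → line a c s a ≡ c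
  line-at-base = solve 3 (λ a c s → c :+ s :* (a :- a) := c) refl

  line-rebase : ∀ a c s A X → line a c s X ≡ line A (line a c s A) s X
  line-rebase = solve 5 (λ a c s A X → c :+ s :* (X :- a) := (c :+ s :* (A :- a)) :+ s :* (X :- A)) refl

  private
    -- Intermediate values without continuity: if the gap between the lines is `d` at `A` and the
    -- reversed gap is `e` at `B`, they meet at the fraction d / (d + e) of the way from `A` to `B`.
    meet : ∀ A B c s c′ s′ → A < B → c < c′ → line A c′ s′ B < line A c s B →
           ∃ λ X → A < X × X < B × line A c s X ≡ line A c′ s′ X
    meet A B c s c′ s′ A<B lt gt = X , A<X , X<B , x-y≡0⇒x≡y eq
      where
        d = c′ - c
        e = line A c s B - line A c′ s′ B
        0<d = <⇒0<- lt
        0<e = <⇒0<- gt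
        D = d + e
        0<D = +-pos 0<d 0<e
        i = inv D
        iD = inv-* (>⇒≢ 0<D)
        X = A + (B - A) * (d * i)
        A<X : A < X
        A<X = 0<⇒< (*-pos (<⇒0<- A<B) (*-pos 0<d (inv-pos 0<D)))
                   (solve 4 (λ A B d i → (B :- A) :* (d :* i) := (A :+ (B :- A) :* (d :* i)) :- A) refl A B d i)
        X<B : X < B
        X<B = 0<⇒< (*-pos (<⇒0<- A<B) (*-pos 0<e (inv-pos 0<D)))
          (trans (solve 5 (λ A B d e i → (B :- A) :* (e :* i) := (B :- A) :* (i :* (d :+ e)) :- (B :- A) :* (d :* i)) refl A B d e i)
          (trans (cong (λ z → (B - A) * z - (B - A) * (d * i)) iD)
                 (solve 4 (λ A B d i → (B :- A) :* :1 :- (B :- A) :* (d :* i) := B :- (A :+ (B :- A) :* (d :* i))) refl A B d i)))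
        eq : line A c s X - line A c′ s′ X ≡ 0r
        eq = trans (solve 7 (λ A B c s c′ s′ i →
                 let d = c′ :- c
                     e = (c :+ s :* (B :- A)) :- (c′ :+ s′ :* (B :- A))
                     X = A :+ (B :- A) :* (d :* i)
                 in (c :+ s :* (X :- A)) :- (c′ :+ s′ :* (X :- A)) := d :* (i :* (d :+ e)) :- d) refl A B c s c′ s′ i)
             (trans (cong (λ z → d * z - d) iD) (solve 1 (λ d → d :* :1 :- d := :0) refl d))

  lines-meet : ∀ {a c s a′ c′ s′} A B → A < B →
               line a c s A < line a′ c′ s′ A → line a′ c′ s′ B < line a c s B →
               ∃ λ X → A < X × X < B × line a c s X ≡ line a′ c′ s′ X
  lines-meet {a} {c} {s} {a′} {c′} {s′} A B A<B lt gt =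
    let X , A<X , X<B , eq = meet A B _ s _ s′ A<B lt
          (subst₂ _<_ (line-rebase a′ c′ s′ A B) (line-rebase a c s A B) gt)
    in X , A<X , X<B , trans (line-rebase a c s A X) (trans eq (sym (line-rebase a′ c′ s′ A X)))

  line-mono-slope : ∀ {a c s s′ X} → a < X → s < s′ → line a c s X < line a c s′ X
  line-mono-slope {a} {c} {s} {s′} {X} a<X s<s′ = 0<⇒< (*-pos (<⇒0<- s<s′) (<⇒0<- a<X))
    (solve 5 (λ a c s s′ X → (s′ :- s) :* (X :- a) := (c :+ s′ :* (X :- a)) :- (c :+ s :* (X :- a))) refl a c s s′ X)

  line-cancel-slope : ∀ {a c s s′ X} → a < X → line a c s X < line a c s′ X → s < s′
  line-cancel-slope {a} {c} {s} {s′} a<X lt with <-tri s s′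
  ... | tri< s<s′ _ _ = s<s′
  ... | tri≈ _ refl _ = ⊥-elim (<-irrefl lt)
  ... | tri> _ _ s′<s = ⊥-elim (<⇒≤ lt (line-mono-slope a<X s′<s))

  -- The three cases are the signs of `s`. This form yields at once that an affine function on an
  -- interval is bounded by its values at the ends.
  line-monotone : ∀ a c s {A B X} → A < X → X < B →
    (line a c s A < line a c s X × line a c s X < line a c s B) ⊎ line a c s X ≡ line a c s A ⊎
    (line a c s X < line a c s A × line a c s B < line a c s X)
  line-monotone a c s {A} {B} {X} A<X X<B with <-tri 0r s
  ... | tri< 0<s _ _ = inj₁ (up A<X , up X<B)
    where up : ∀ {U V} → U < V → line a c s U < line a c s V
          up {U} {V} U<V = 0<⇒< (*-pos 0<s (<⇒0<- U<V))
            (solve 5 (λ a c s U V → s :* (V :- U) := (c :+ s :* (V :- a)) :- (c :+ s :* (U :- a))) refl a c s U V)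
  ... | tri≈ _ refl _ = inj₂ (inj₁ (solve 4 (λ a c A X → c :+ :0 :* (X :- a) := c :+ :0 :* (A :- a)) refl a c A X))
  ... | tri> _ _ s<0 = inj₂ (inj₂ (down A<X , down X<B))
    where down : ∀ {U V} → U < V → line a c s V < line a c s U
          down {U} {V} U<V = 0<⇒< (*-pos (<⇒0<- s<0) (<⇒0<- U<V))
            (solve 5 (λ a c s U V → (:0 :- s) :* (V :- U) := (c :+ s :* (U :- a)) :- (c :+ s :* (V :- a))) refl a c s U V)

  line-max : ∀ a c s {A B X m} → A < X → X < B → line a c s A ≤ m → line a c s B ≤ m → line a c s X ≤ m
  line-max a c s A<X X<B lA lB m<lX with line-monotone a c s A<X X<B
  ... | inj₁ (_ , X<B′)        = lB (<-trans m<lX X<B′)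
  ... | inj₂ (inj₁ eq)         = lA (subst (_ <_) eq m<lX)
  ... | inj₂ (inj₂ (X<A′ , _)) = lA (<-trans m<lX X<A′)

  line-min : ∀ a c s {A B X m} → A < X → X < B → m ≤ line a c s A → m ≤ line a c s B → m ≤ line a c s X
  line-min a c s A<X X<B lA lB lX<m with line-monotone a c s A<X X<B
  ... | inj₁ (A<X′ , _)        = lA (<-trans A<X′ lX<m)
  ... | inj₂ (inj₁ eq)         = lA (subst (_< _) eq lX<m)
  ... | inj₂ (inj₂ (_ , B<X′)) = lB (<-trans B<X′ lX<m)

  -- Makes `line-max` and `line-min` applicable to the vertical distance between an edge and a fixed
  -- line.
  line-difference : ∀ a c s a′ c′ s′ X →
    line a (c - line a′ c′ s′ a) (s - s′) X ≡ line a c s X - line a′ c′ s′ X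
  line-difference = solve 7 (λ a c s a′ c′ s′ X →
    (c :- (c′ :+ s′ :* (a :- a′))) :+ (s :- s′) :* (X :- a) :=
    (c :+ s :* (X :- a)) :- (c′ :+ s′ :* (X :- a′))) refl

-- The bound 3n - 6 for plane straight-line graphs with distinct abscissae.

module PlaneGraph (ℝ : Reals) {n : ℕ} (x y : Fin n → Reals.R ℝ) (x-injective : Injective _≡_ _≡_ x) where
  open Reals ℝ
  open OrderedField ℝ
  open Extrema ℝ
  open Lines ℝ

  slope : Fin n → Fin n → R
  slope i j = (y j - y i) * inv (x j - x i)

  height : Fin n → Fin n → R → R
  height i j = line (x i) (y i) (slope i j)

  height-left : ∀ i j → height i j (x i) ≡ y i
  height-left i j = line-at-base (x i) (y i) (slope i j)

  height-right : ∀ {i j} → x i < x j → height i j (x j) ≡ y j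
  height-right {i} {j} lt =
    trans (solve 4 (λ yi yj d i → yi :+ ((yj :- yi) :* i) :* d := yi :+ (yj :- yi) :* (i :* d)) refl
            (y i) (y j) (x j - x i) (inv (x j - x i)))
    (trans (cong (λ z → y i + (y j - y i) * z) (inv-* (>⇒≢ (<⇒0<- lt))))
           (solve 2 (λ yi yj → yi :+ (yj :- yi) :* :1 := yj) refl (y i) (y j)))

  -- S i j says that i j is an edge with left end i.
  module _ (S : Fin n → Fin n → Set) (S? : ∀ i j → Dec (S i j))
           (S⇒< : ∀ {i j} → S i j → x i < x j)
           (vertex-off-edge : ∀ {i j k} → S i j → x i < x k → x k < x j → height i j (x k) ≢ y k)
           (edges-disjoint : ∀ {i j k l X} → S i j → S k l → x i < X → X < x j → x k < X → X < x l →
                             height i j X ≡ height k l X → i ≡ k × j ≡ l) where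

    private
      Spans : Fin n → Fin n → Fin n → Set
      Spans i j w = S i j × x i < x w × x w < x j

      ImmediatelyBelow ImmediatelyAbove : Fin n → Fin n → Fin n → Set
      ImmediatelyBelow i j w = Spans i j w × height i j (x w) < y w ×
        (∀ {p q} → Spans p q w → height p q (x w) < y w → height p q (x w) ≤ height i j (x w))
      ImmediatelyAbove i j w = Spans i j w × y w < height i j (x w) ×
        (∀ {p q} → Spans p q w → y w < height p q (x w) → height i j (x w) ≤ height p q (x w))

      Code : Set
      Code = Fin n × Fin 3

      -- An edge leaving i as the steepest one is charged to i; any other edge i j is charged to
      -- the leftmost vertex w of the wedge between i j and the next steeper edge i k.
      _∼_ : Fin n × Fin n → Code → Set
      (i , j) ∼ (w , zero) = w ≡ i × S i j × (∀ {k} → S i k → slope i k ≤ slope i j)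
      (i , j) ∼ (w , suc zero) = ImmediatelyBelow i j w
      (i , j) ∼ (w , suc (suc zero)) = j ≡ w × ∃ λ k → ImmediatelyAbove i k w

      -- Two edges leaving `i` with one slope lie on a common line, so the nearer of two distinct
      -- right ends would lie inside the longer edge.
      same-slope : ∀ {i j k} → S i j → S i k → slope i j ≡ slope i k → j ≡ k
      same-slope {i} {j} {k} Sij Sik eq with <-tri (x j) (x k)
      ... | tri≈ _ xj≡xk _ = x-injective xj≡xk
      ... | tri< lt _ _ = ⊥-elim (vertex-off-edge Sik (S⇒< Sij) lt
              (trans (cong (λ s → line (x i) (y i) s (x j)) (sym eq)) (height-right (S⇒< Sij))))
      ... | tri> _ _ gt = ⊥-elim (vertex-off-edge Sij (S⇒< Sik) gt
              (trans (cong (λ s → line (x i) (y i) s (x k)) eq) (height-right (S⇒< Sik))))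

      spans-same-height : ∀ {i j k l w} → Spans i j w → Spans k l w →
                          height i j (x w) ≡ height k l (x w) → (i , j) ≡ (k , l)
      spans-same-height (Sij , iw , wj) (Skl , kw , wl) eq =
        let i≡k , j≡l = edges-disjoint Sij Skl iw wj kw wl eq in cong₂ _,_ i≡k j≡l

      -- Each slot of `w` recovers its edge. The steepest edge leaving `w` is unique, and so is the
      -- edge directly below `w`. The edge directly above `w` is unique too and supplies the left
      -- end of the charged edge, whose right end is `w`.
      ∼-injective : ∀ {e f c} → e ∼ c → f ∼ c → e ≡ f
      ∼-injective {c = w , zero} (refl , Sij , top) (refl , Sij′ , top′) =
        cong (w ,_) (same-slope Sij Sij′ (≤-antisym (top′ Sij) (top Sij′)))
      ∼-injective {c = w , suc zero} (sp , lt , max) (sp′ , lt′ , max′) =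
        spans-same-height sp sp′ (≤-antisym (max′ sp lt) (max sp′ lt′))
      ∼-injective {c = w , suc (suc zero)} (refl , k , sp , lt , min) (refl , k′ , sp′ , lt′ , min′) =
        cong (λ e → proj₁ e , w) (spans-same-height sp sp′ (≤-antisym (min sp′ lt′) (min′ sp lt)))

      -- A change of vertical order between `A` and `B` forces a common point strictly in between,
      -- so the bounds on `A` and `B` may be weak. The conclusion is used for contradictions, by
      -- comparing left ends.
      crosses : ∀ {i j k l A B} → S i j → S k l → A < B → x i ≤ A → B ≤ x j → x k ≤ A → B ≤ x l →
                height i j A < height k l A → height k l B < height i j B → i ≡ k × j ≡ l
      crosses {A = A} {B} Sij Skl A<B iA Bj kA Bl lt gt =
        let X , A<X , X<B , eq = lines-meet A B A<B lt gt
        in edges-disjoint Sij Skl (≤-<-trans iA A<X) (<-≤-trans X<B Bj) (≤-<-trans kA A<X) (<-≤-trans X<B Bl) eq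

      module Wedge {i j k} (Sij : S i j) (Sik : S i k) (steeper : slope i j < slope i k)
                   (next : ∀ {l} → S i l → slope i j < slope i l → slope i k ≤ slope i l) where

        -- The closed triangle cut from the wedge by the vertical line through the nearer of the two
        -- right ends, without its apex `i`.
        InWedge : Fin n → Set
        InWedge w = x i < x w × x w ≤ x j × x w ≤ x k × height i j (x w) ≤ y w × y w ≤ height i k (x w)

        inWedge? : ∀ w → Dec (InWedge w)
        inWedge? w = (x i <? x w) ×-dec ¬? (x j <? x w) ×-dec ¬? (x k <? x w) ×-dec
                     ¬? (y w <? height i j (x w)) ×-dec ¬? (height i k (x w) <? y w)

        -- The nearer of `j` and `k` belongs to the wedge, so a leftmost vertex of the wedge exists.
        nonempty : ∃ InWedge
        nonempty with x k <? x j
        ... | yes k<j = k , S⇒< Sik , <⇒≤ k<j , ≤-refl ,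
                <⇒≤ (subst (height i j (x k) <_) (height-right (S⇒< Sik)) (line-mono-slope (S⇒< Sik) steeper)) ,
                ≡⇒≤ (sym (height-right (S⇒< Sik)))
        ... | no j≤k = j , S⇒< Sij , ≤-refl , j≤k ,
                ≡⇒≤ (height-right (S⇒< Sij)) ,
                <⇒≤ (subst (_< height i k (x j)) (height-right (S⇒< Sij)) (line-mono-slope (S⇒< Sij) steeper))

        module _ {w} (w∈ : InWedge w) (leftmost : ∀ v → InWedge v → x w ≤ x v) where

          private
            i<w = proj₁ w∈
            w≤j = proj₁ (proj₂ w∈)
            w≤k = proj₁ (proj₂ (proj₂ w∈))

          -- Follow p q leftwards from the abscissa of `w`, where it runs strictly inside the wedge.
          -- It cannot cross a side of the wedge. If it starts at `i`, its slope contradicts `next`.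
          -- If it starts right of `i`, then `p` is a vertex of the wedge to the left of `w`. If it
          -- starts left of `i`, it must pass through the vertex `i`.
          empty-left : ∀ {p q} → Spans p q w → height i j (x w) < height p q (x w) →
                       height p q (x w) < height i k (x w) → ⊥
          empty-left {p} {q} (Spq , p<w , w<q) above below with <-tri (x p) (x i)
          ... | tri≈ _ xp≡xi _ with refl ← x-injective xp≡xi =
                  next Spq (line-cancel-slope p<w above) (line-cancel-slope p<w below)
          ... | tri> _ _ i<p = leftmost p
                  (i<p , ≤-trans (<⇒≤ p<w) w≤j , ≤-trans (<⇒≤ p<w) w≤k ,
                   (λ lt → <⇒≢ i<p (cong x (sym (proj₁ (crosses Spq Sij p<w ≤-refl (<⇒≤ w<q) (<⇒≤ i<p) w≤j
                             (subst (_< height i j (x p)) (sym (height-left p q)) lt) above))))) ,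
                   (λ gt → <⇒≢ i<p (cong x (proj₁ (crosses Sik Spq p<w (<⇒≤ i<p) w≤k ≤-refl (<⇒≤ w<q)
                             (subst (height i k (x p) <_) (sym (height-left p q)) gt) below)))))
                  p<w
          ... | tri< p<i _ _ with <-tri (height p q (x i)) (y i)
          ...   | tri≈ _ eq _ = vertex-off-edge Spq p<i (<-trans i<w w<q) eq
          ...   | tri< lt _ _ = <⇒≢ p<i (cong x (proj₁ (crosses Spq Sij i<w (<⇒≤ p<i) (<⇒≤ w<q) ≤-refl w≤j
                                  (subst (height p q (x i) <_) (sym (height-left i j)) lt) above)))
          ...   | tri> _ _ gt = <⇒≢ p<i (cong x (sym (proj₁ (crosses Sik Spq i<w ≤-refl w≤k (<⇒≤ p<i) (<⇒≤ w<q)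
                                  (subst (_< height p q (x i)) (sym (height-left i k)) gt) below))))

        -- By `empty-left`, no edge runs strictly between the sides of the wedge at the abscissa of
        -- `w`. So `i k` is directly above `w` if `w` is `j`, and otherwise, also if `w` is `k`, the
        -- edge `i j` is directly below `w`.
        charge : ∃ ((i , j) ∼_)
        charge with argmin inWedge? x nonempty
        ... | w , w∈@(i<w , w≤j , w≤k , j≤w , w≤k′) , leftmost with w Fin.≟ j
        ...   | yes refl = (w , suc (suc zero)) , refl , k , (Sik , i<w , w<k) ,
                  subst (_< height i k (x w)) (height-right i<w) (line-mono-slope i<w steeper) ,
                  λ {p} {q} sp above below → empty-left w∈ leftmost sp
                    (subst (_< height p q (x w)) (sym (height-right i<w)) above) below
          where
            -- Equal abscissae would make `j` and `k` the same vertex, although their slopes from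
            -- `i` differ.
            w<k = ≤∧≢⇒< w≤k λ eq → <⇒≢ steeper (cong (slope i) (x-injective eq))
        ...   | no w≢j = (w , suc zero) , (Sij , i<w , w<j) ,
                  ≤∧≢⇒< j≤w (vertex-off-edge Sij i<w w<j) ,
                  λ sp below above → empty-left w∈ leftmost sp above (<-≤-trans below w≤k′)
          where
            w<j = ≤∧≢⇒< w≤j λ eq → w≢j (x-injective eq)

      charge : ∀ {i j} → S i j → ∃ ((i , j) ∼_)
      charge {i} {j} Sij with FinP.any? (λ k → S? i k ×-dec (slope i j <? slope i k))
      ... | no ¬∃ = (i , zero) , refl , Sij , λ Sik lt → ¬∃ (_ , Sik , lt)
      ... | yes ∃k with argmin (λ k → S? i k ×-dec (slope i j <? slope i k)) (slope i) ∃k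
      ...   | k , (Sik , steeper) , next = Wedge.charge Sij Sik steeper (λ Sil lt → next _ (Sil , lt))

      module Extremes {vL vR : Fin n} (leftmost : ∀ v → x vL ≤ x v) (rightmost : ∀ v → x v ≤ x vR)
                      (vL≢vR : vL ≢ vR) where

        -- Signed vertical distance from the line through `vL` and `vR`. It is a fixed multiple of
        -- the orthogonal distance, so both have the same extremal vertices, and it is affine along
        -- edges.
        dist : Fin n → R
        dist v = y v - height vL vR (x v)

        vL<vR : x vL < x vR
        vL<vR = ≤∧≢⇒< (leftmost vR) λ eq → vL≢vR (x-injective eq)

        dist-vL : dist vL ≡ 0r
        dist-vL = trans (cong (λ z → y vL - z) (height-left vL vR)) (+-invʳ (y vL))

        dist-vR : dist vR ≡ 0r
        dist-vR = trans (cong (λ z → y vR - z) (height-right vL<vR)) (+-invʳ (y vR))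

        module _ {i j : Fin n} (i<j : x i < x j) where

          private
            Δ : R → R
            Δ = line (x i) (y i - height vL vR (x i)) (slope i j - slope vL vR)

            Δ-≡ : ∀ X → Δ X ≡ height i j X - height vL vR X
            Δ-≡ = line-difference (x i) (y i) (slope i j) (x vL) (y vL) (slope vL vR)

            Δ-left : Δ (x i) ≡ dist i
            Δ-left = trans (Δ-≡ (x i)) (cong (λ z → z - height vL vR (x i)) (height-left i j))

            Δ-right : Δ (x j) ≡ dist j
            Δ-right = trans (Δ-≡ (x j)) (cong (λ z → z - height vL vR (x j)) (height-right i<j))

          -- Along i j the vertical distance to the line `vL vR` is the affine function `Δ`, so it
          -- cannot exceed the larger of its values at the ends, and `dist w` bounds both of these.
          below-highest : ∀ {w} → (∀ v → dist v ≤ dist w) → x i < x w → x w < x j → height i j (x w) ≤ y w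
          below-highest {w} max i<w w<j lt =
            line-max (x i) (y i - height vL vR (x i)) (slope i j - slope vL vR) i<w w<j
              (subst (_≤ dist w) (sym Δ-left) (max i)) (subst (_≤ dist w) (sym Δ-right) (max j))
              (subst (dist w <_) (sym (Δ-≡ (x w))) (+-mono-< _ lt))

          above-lowest : ∀ {w} → (∀ v → dist w ≤ dist v) → x i < x w → x w < x j → y w ≤ height i j (x w)
          above-lowest {w} min i<w w<j lt =
            line-min (x i) (y i - height vL vR (x i)) (slope i j - slope vL vR) i<w w<j
              (subst (dist w ≤_) (sym Δ-left) (min i)) (subst (dist w ≤_) (sym Δ-right) (min j))
              (subst (_< dist w) (sym (Δ-≡ (x w))) (+-mono-< _ lt))

        Other : Fin n → Set
        Other v = v ≢ vL × v ≢ vR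

        other? : ∀ v → Dec (Other v)
        other? v = ¬? (v Fin.≟ vL) ×-dec ¬? (v Fin.≟ vR)

        -- A vertex other than vL, vR that is extremal in the direction normal to vL vR has no
        -- edge above it or none below it, so one of its two side charges is never used.
        unused-side : ∃ Other → ∃ λ w → Other w × ∃ λ d → d ≢ zero × (∀ {e} → ¬ (e ∼ (w , d)))
        unused-side (u , u-other) with dist u <? 0r
        ... | no 0≤u with argmax other? dist (u , u-other)
        ...   | w , w-other , max = w , w-other , suc (suc zero) , (λ ()) ,
                λ { (_ , k , (Sik , i<w , w<k) , lt , _) → below-highest (S⇒< Sik) max-all i<w w<k lt }
          where
            -- The case distinction on the sign of `dist u` serves to make the extremum over the
            -- other vertices an extremum over all of them, since `dist` vanishes at `vL` and `vR`.
            0≤w : 0r ≤ dist w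
            0≤w = ≤-trans 0≤u (max u u-other)
            max-all : ∀ v → dist v ≤ dist w
            max-all v with v Fin.≟ vL | v Fin.≟ vR
            ... | yes refl | _        = subst (_≤ dist w) (sym dist-vL) 0≤w
            ... | _        | yes refl = subst (_≤ dist w) (sym dist-vR) 0≤w
            ... | no v≢vL  | no v≢vR  = max v (v≢vL , v≢vR)
        unused-side (u , u-other) | yes u<0 with argmin other? dist (u , u-other)
        ...   | w , w-other , min = w , w-other , suc zero , (λ ()) ,
                λ { ((Sij , i<w , w<j) , lt , _) → above-lowest (S⇒< Sij) min-all i<w w<j lt }
          where
            w≤0 : dist w ≤ 0r
            w≤0 = ≤-trans (min u u-other) (<⇒≤ u<0)
            min-all : ∀ v → dist w ≤ dist v
            min-all v with v Fin.≟ vL | v Fin.≟ vR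
            ... | yes refl | _        = subst (dist w ≤_) (sym dist-vL) w≤0
            ... | _        | yes refl = subst (dist w ≤_) (sym dist-vR) w≤0
            ... | no v≢vL  | no v≢vR  = min v (v≢vL , v≢vR)

        -- Otherwise every vertex is `vL` or `vR`, and `side` would map at least three vertices
        -- injectively into two values.
        other-exists : 3 ℕ.≤ n → ∃ Other
        other-exists 3≤n with FinP.any? other?
        ... | yes ∃v = ∃v
        ... | no ¬∃v = ⊥-elim (separated (FinP.pigeonhole 3≤n side))
          where
            side : Fin n → Fin 2
            side v with v Fin.≟ vL
            ... | yes _ = zero
            ... | no _  = suc zero
            ≡vR : ∀ {v} → v ≢ vL → v ≡ vR
            ≡vR {v} v≢vL with v Fin.≟ vR
            ... | yes v≡vR = v≡vR
            ... | no v≢vR  = ⊥-elim (¬∃v (v , v≢vL , v≢vR))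
            separated : ¬ (∃ λ i → ∃ λ j → i Fin.< j × side i ≡ side j)
            separated (i , j , i<j , eq) with i Fin.≟ vL | j Fin.≟ vL
            ... | yes refl | yes refl = FinP.<-irrefl refl i<j
            ... | no i≢    | no j≢    = FinP.<-irrefl (trans (≡vR i≢) (sym (≡vR j≢))) i<j

        bound : 3 ℕ.≤ n → ∀ {E} → Unique E → (∀ {e} → e ∈ E → S (proj₁ e) (proj₂ e)) →
                length E ℕ.+ 6 ℕ.≤ n ℕ.* 3
        bound 3≤n E-unique E⊆S with unused-side (other-exists 3≤n)
        ... | w , (w≢vL , w≢vR) , d , d≢0 , unused =
          length+missed≤ _∼_ ∼-injective X-unique missed
            (λ {a} {b} eq → let p , q = FinP.combine-injective (proj₁ a) (proj₂ a) (proj₁ b) (proj₂ b) eq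
                            in cong₂ _,_ p q)
            E-unique (λ e∈E → charge (E⊆S e∈E))
          where
            X : List Code
            X = (vR , zero) ∷ (vL , suc zero) ∷ (vL , suc (suc zero)) ∷ (vR , suc zero) ∷
                (vR , suc (suc zero)) ∷ (w , d) ∷ []

            ≢₁ : ∀ {a b : Code} → proj₁ a ≢ proj₁ b → a ≢ b
            ≢₁ ne refl = ne refl

            ≢₂ : ∀ {a b : Code} → proj₂ a ≢ proj₂ b → a ≢ b
            ≢₂ ne refl = ne refl

            vL≢w : vL ≢ w
            vL≢w eq = w≢vL (sym eq)
            vR≢w : vR ≢ w
            vR≢w eq = w≢vR (sym eq)

            X-unique : Unique X
            X-unique =
              (≢₂ (λ ()) ∷ ≢₂ (λ ()) ∷ ≢₂ (λ ()) ∷ ≢₂ (λ ()) ∷ ≢₁ vR≢w ∷ []) ∷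
              (≢₂ (λ ()) ∷ ≢₁ vL≢vR ∷ ≢₂ (λ ()) ∷ ≢₁ vL≢w ∷ []) ∷
              (≢₂ (λ ()) ∷ ≢₁ vL≢vR ∷ ≢₁ vL≢w ∷ []) ∷
              (≢₂ (λ ()) ∷ ≢₁ vR≢w ∷ []) ∷
              (≢₁ vR≢w ∷ []) ∷ [] ∷ []

            missed : ∀ {e c} → e ∼ c → c ∉ X
            missed (refl , Sij , _) (here refl) = rightmost _ (S⇒< Sij)
            missed ((_ , lt , _) , _) (there (here refl)) = leftmost _ lt
            missed (_ , _ , (_ , lt , _) , _) (there (there (here refl))) = leftmost _ lt
            missed ((_ , _ , lt) , _) (there (there (there (here refl)))) = rightmost _ lt
            missed (_ , _ , (_ , _ , lt) , _) (there (there (there (there (here refl))))) = rightmost _ lt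
            missed e∼c (there (there (there (there (there (here refl)))))) = unused e∼c

    edge-bound : 3 ℕ.≤ n → ∀ {E} → Unique E → (∀ {e} → e ∈ E → S (proj₁ e) (proj₂ e)) →
                 length E ℕ.+ 6 ℕ.≤ n ℕ.* 3
    edge-bound 3≤n@(ℕ.s≤s (ℕ.s≤s (ℕ.s≤s _)))
      with argmin {P = λ _ → ⊤} (λ _ → yes tt) x (zero , tt) | argmax {P = λ _ → ⊤} (λ _ → yes tt) x (zero , tt)
    ... | vL , _ , leftmost | vR , _ , rightmost =
      Extremes.bound (λ v → leftmost v tt) (λ v → rightmost v tt) vL≢vR 3≤n
      where
        vL≢vR : vL ≢ vR
        vL≢vR refl with () ← x-injective (trans (≤-antisym (rightmost zero tt) (leftmost zero tt))
                                                (≤-antisym (leftmost (suc zero) tt) (rightmost (suc zero) tt)))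

-- Segments and a generic shear.

map-unique-on : ∀ {A B : Set} {f : A → B} {xs} → (∀ {a b} → a ∈ xs → b ∈ xs → f a ≡ f b → a ≡ b) →
                Unique xs → Unique (map f xs)
map-unique-on inj [] = []
map-unique-on {f = f} {x ∷ xs} inj (x∉ ∷ u) =
  All.tabulate (λ {b} b∈ eq → let a , a∈ , b≡fa = ∈-map⁻ f b∈
                              in All.lookup x∉ a∈ (inj (here refl) (there a∈) (trans eq b≡fa))) ∷
  map-unique-on (λ a∈ b∈ → inj (there a∈) (there b∈)) u

module Segments (ℝ : Reals) where
  open Reals ℝ
  open OrderedField ℝ
  open Geometry ℝ

  ratio : R → R → R → R
  ratio A B X = (X - A) * inv (B - A)

  ratio-∈ : ∀ {A B X} → A < X → X < B → 0r < ratio A B X × ratio A B X < 1r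
  ratio-∈ {A} {B} {X} A<X X<B =
    *-pos (<⇒0<- A<X) (inv-pos 0<d) ,
    0<⇒< (*-pos (<⇒0<- X<B) (inv-pos 0<d))
      (trans (solve 4 (λ A B X i → (B :- X) :* i := i :* (B :- A) :- (X :- A) :* i) refl A B X (inv (B - A)))
             (cong (λ z → z - ratio A B X) (inv-* (>⇒≢ 0<d))))
    where 0<d = <⇒0<- (<-trans A<X X<B)

  ratio-≡ : ∀ {A B X} → A < B → X ≡ A + ratio A B X * (B - A)
  ratio-≡ {A} {B} {X} A<B = sym
    (trans (solve 4 (λ A B X i → A :+ (X :- A) :* i :* (B :- A) := A :+ (X :- A) :* (i :* (B :- A))) refl A B X (inv (B - A)))
    (trans (cong (λ z → A + (X - A) * z) (inv-* (>⇒≢ (<⇒0<- A<B))))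
           (solve 2 (λ A X → A :+ (X :- A) :* :1 := X) refl A X)))

  open-flip : ∀ {p a b} → OnOpenSeg p a b → OnOpenSeg p b a
  open-flip {p} {ax , ay} {bx , by} (t , 0<t , t<1 , ex , ey) =
    1r - t , <⇒0<- t<1 ,
    0<⇒< 0<t (solve 1 (λ t → t := :1 :- (:1 :- t)) refl t) ,
    trans ex (flip ax bx t) , trans ey (flip ay by t)
    where flip = solve 3 (λ a b t → a :+ t :* (b :- a) := b :+ (:1 :- t) :* (a :- b)) refl

  open⇒closed : ∀ {p a b} → OnOpenSeg p a b → OnClosedSeg p a b
  open⇒closed (t , 0<t , t<1 , ex , ey) = t , <⇒≤ 0<t , <⇒≤ t<1 , ex , ey

  -- Reflection in the line x = y, by which the bound for columns yields the bound for rows.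
  open-swap : ∀ {px py ax ay bx by} → OnOpenSeg (px , py) (ax , ay) (bx , by) → OnOpenSeg (py , px) (ay , ax) (by , bx)
  open-swap (t , 0<t , t<1 , ex , ey) = t , 0<t , t<1 , ey , ex

  closed-swap : ∀ {px py ax ay bx by} → OnClosedSeg (px , py) (ax , ay) (bx , by) → OnClosedSeg (py , px) (ay , ax) (by , bx)
  closed-swap (t , 0≤t , t≤1 , ex , ey) = t , 0≤t , t≤1 , ey , ex

module Shear (ℝ : Reals) {n : ℕ} (x y : Fin n → Reals.R ℝ)
             (point-injective : ∀ {i j} → x i ≡ x j → y i ≡ y j → i ≡ j) where
  open Reals ℝ
  open OrderedField ℝ
  open Extrema ℝ

  private
    -- The only shear that could identify the abscissae of i and j.
    bad : Fin n → Fin n → R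
    bad i j = (x i - x j) * inv (y j - y i)

    bad-unique : ∀ {i j} ε → i ≢ j → x i + ε * y i ≡ x j + ε * y j → ε ≡ bad i j
    bad-unique {i} {j} ε i≢j eq with y i ≟ y j
    ... | yes yi≡yj = ⊥-elim (i≢j (point-injective
            (trans (solve 3 (λ xi ε yi → xi := xi :+ ε :* yi :- ε :* yi) refl (x i) ε (y i))
            (trans (cong (λ z → z - ε * y i) eq)
            (trans (cong (λ z → x j + ε * y j - ε * z) yi≡yj)
                   (solve 3 (λ xj ε yj → xj :+ ε :* yj :- ε :* yj := xj) refl (x j) ε (y j))))) yi≡yj))
    ... | no yi≢yj =
            trans (solve 1 (λ ε → ε := ε :* :1) refl ε)
            (trans (cong (ε *_) (sym (inv-* (x≢y⇒x-y≢0 λ e → yi≢yj (sym e)))))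
            (trans (solve 5 (λ ε i yi yj xj → ε :* (i :* (yj :- yi)) := ((xj :+ ε :* yj) :- ε :* yi :- xj) :* i) refl ε (inv (y j - y i)) (y i) (y j) (x j))
            (trans (cong (λ z → (z - ε * y i - x j) * inv (y j - y i)) (sym eq))
                   (solve 5 (λ ε i yi xi xj → ((xi :+ ε :* yi) :- ε :* yi :- xj) :* i := (xi :- xj) :* i) refl ε (inv (y j - y i)) (y i) (x i) (x j)))))

  -- Each pair of vertices excludes at most the one value `bad i j`, so a number exceeding all of
  -- these finitely many values will do.
  generic-shear : ∃ λ ε → Injective _≡_ _≡_ (λ i → x i + ε * y i)
  generic-shear = let row i = upper-bound (bad i)
                      B , B-max = upper-bound (λ i → proj₁ (row i))
                  in B + 1r , λ {i} {j} eq → separate B B-max eq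
    where
      separate : ∀ B → (∀ i → proj₁ (upper-bound (bad i)) ≤ B) → ∀ {i j} →
                 x i + (B + 1r) * y i ≡ x j + (B + 1r) * y j → i ≡ j
      separate B B-max {i} {j} eq with i Fin.≟ j
      ... | yes i≡j = i≡j
      ... | no i≢j = ⊥-elim (≤-trans (proj₂ (upper-bound (bad i)) j) (B-max i)
                       (subst (B <_) (bad-unique (B + 1r) i≢j eq)
                         (0<⇒< 0<1 (solve 1 (λ B → :1 := (B :+ :1) :- B) refl B))))

-- Columns and rows of a finite point set.

module Columns (ℝ : Reals) {n : ℕ} (x y : Fin n → Reals.R ℝ) where
  open Reals ℝ
  open OrderedField ℝ
  open Extrema ℝ

  IsTop : Fin n → Set
  IsTop v = ∀ w → x w ≡ x v → y w ≤ y v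

  isTop? : Decidable IsTop
  isTop? v = FinP.all? λ w → (x w ≟ x v) →-dec ¬? (y v <? y w)

  -- For distinct points there is exactly one top per column, so the length of this list is the
  -- number of columns.
  tops : List (Fin n)
  tops = filter isTop? (allFin n)

  top-of : ∀ v → ∃ λ t → t ∈ tops × x t ≡ x v
  top-of v with argmax (λ w → x w ≟ x v) y (v , refl)
  ... | t , xt≡xv , max = t , ∈-filter⁺ isTop? (∈-allFin t) (λ w e → max w (trans e xt≡xv)) , xt≡xv

index-injective : ∀ {A : Set} {xs : List A} {a b} (a∈ : a ∈ xs) (b∈ : b ∈ xs) →
                  Any.index a∈ ≡ Any.index b∈ → a ≡ b
index-injective {xs = xs} a∈ b∈ eq =
  trans (lookup-index a∈) (trans (cong (lookup xs) eq) (sym (lookup-index b∈)))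

-- A point is determined by its column and its row.
columns*rows : ∀ (ℝ : Reals) {n} (x y : Fin n → Reals.R ℝ) → (∀ {i j} → x i ≡ x j → y i ≡ y j → i ≡ j) →
               n ℕ.≤ length (Columns.tops ℝ x y) ℕ.* length (Columns.tops ℝ y x)
columns*rows ℝ x y inj = FinP.injective⇒≤ {f = f} λ {i} {j} eq →
    let p , q = FinP.combine-injective (col i) (row i) (col j) (row j) eq
    in inj (same x (X.top-of i) (X.top-of j) p) (same y (Y.top-of i) (Y.top-of j) q)
  where
    module X = Columns ℝ x y
    module Y = Columns ℝ y x
    col : ∀ i → Fin (length X.tops)
    col i = Any.index (proj₁ (proj₂ (X.top-of i)))
    row : ∀ i → Fin (length Y.tops)
    row i = Any.index (proj₁ (proj₂ (Y.top-of i)))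
    f : Fin _ → Fin _
    f i = Fin.combine (col i) (row i)
    same : ∀ z {ts i j} → (s : ∃ λ t → t ∈ ts × z t ≡ z i) → (s′ : ∃ λ t → t ∈ ts × z t ≡ z j) →
           Any.index (proj₁ (proj₂ s)) ≡ Any.index (proj₁ (proj₂ s′)) → z i ≡ z j
    same z (t , t∈ , e) (t′ , t′∈ , e′) eq =
      trans (sym e) (trans (cong z (index-injective t∈ t′∈ eq)) e′)

-- Upper bound: vertical and non-vertical edges of a drawing.

module ApRAC (ℝ : Reals) {n : ℕ} (x y : Fin n → Reals.R ℝ)
  (point-injective : ∀ {i j} → x i ≡ x j → y i ≡ y j → i ≡ j)
  (E : List (Fin n × Fin n)) (ordered : All (λ e → proj₁ e Fin.< proj₂ e) E) (unique : Unique E)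
  (no-pass : ∀ {i j} → (i , j) ∈ E → ∀ k → k ≢ i → k ≢ j →
             ¬ Geometry.OnClosedSeg ℝ (x k , y k) (x i , y i) (x j , y j))
  (axis-parallel : ∀ {i j k l} → (i , j) ∈ E → (k , l) ∈ E → (i , j) ≢ (k , l) →
    Geometry.SegsCross ℝ (x i , y i) (x j , y j) (x k , y k) (x l , y l) →
    (y i ≡ y j × x k ≡ x l) ⊎ (x i ≡ x j × y k ≡ y l)) where

  open Reals ℝ
  open OrderedField ℝ
  open Geometry ℝ
  open Segments ℝ
  open Columns ℝ x y

  private
    Joins : Fin n × Fin n → Fin n → Fin n → Set
    Joins e i j = e ≡ (i , j) ⊎ e ≡ (j , i)

    -- As edges are listed with increasing ends, a pair and its reverse are never both present.
    joins-unique : ∀ {e f i j} → e ∈ E → f ∈ E → Joins e i j → Joins f i j → e ≡ f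
    joins-unique _ _ (inj₁ refl) (inj₁ refl) = refl
    joins-unique e∈ f∈ (inj₁ refl) (inj₂ refl) = ⊥-elim (FinP.<-asym (All.lookup ordered e∈) (All.lookup ordered f∈))
    joins-unique e∈ f∈ (inj₂ refl) (inj₁ refl) = ⊥-elim (FinP.<-asym (All.lookup ordered e∈) (All.lookup ordered f∈))
    joins-unique _ _ (inj₂ refl) (inj₂ refl) = refl

    no-vertex-inside : ∀ {e i j k} → e ∈ E → Joins e i j → k ≢ i → k ≢ j → ¬ OnOpenSeg (x k , y k) (x i , y i) (x j , y j)
    no-vertex-inside e∈ (inj₁ refl) k≢i k≢j on = no-pass e∈ _ k≢i k≢j (open⇒closed on)
    no-vertex-inside e∈ (inj₂ refl) k≢i k≢j on = no-pass e∈ _ k≢j k≢i (open⇒closed (open-flip on))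

    IsVertical : Fin n × Fin n → Set
    IsVertical (i , j) = x i ≡ x j

    vertical? : Decidable IsVertical
    vertical? (i , j) = x i ≟ x j

    nonvertical? : Decidable (λ e → ¬ IsVertical e)
    nonvertical? e = ¬? (vertical? e)

    Es-vertical Es-nonvertical : List (Fin n × Fin n)
    Es-vertical    = filter vertical? E
    Es-nonvertical = filter nonvertical? E

    _HasLowerEnd_ : Fin n × Fin n → Fin n → Set
    e HasLowerEnd v = ∃ λ u → e ∈ E × Joins e v u × x u ≡ x v × y v < y u

    on-column : ∀ {u v w} → x u ≡ x v → x w ≡ x v → y v < y u → y u < y w →
                OnOpenSeg (x u , y u) (x v , y v) (x w , y w)
    on-column {u} {v} {w} u≡v w≡v v<u u<w =
      let 0<t , t<1 = ratio-∈ v<u u<w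
      in t , 0<t , t<1 ,
         trans u≡v (trans (solve 2 (λ a t → a := a :+ t :* (a :- a)) refl (x v) t)
                          (cong (λ z → x v + t * (z - x v)) (sym w≡v))) ,
         ratio-≡ (<-trans v<u u<w)
      where t = ratio (y v) (y w) (y u)

    -- If two vertical edges went up from `v` to different vertices, the lower of these would lie
    -- inside the longer edge.
    lowerEnd-injective : ∀ {e f v} → e HasLowerEnd v → f HasLowerEnd v → e ≡ f
    lowerEnd-injective {v = v} (u , e∈ , je , xu , lt) (u′ , f∈ , jf , xu′ , lt′) with <-tri (y u) (y u′)
    ... | tri≈ _ yu _ with refl ← point-injective (trans xu (sym xu′)) yu = joins-unique e∈ f∈ je jf
    ... | tri< u<u′ _ _ = ⊥-elim (no-vertex-inside f∈ jf (λ { refl → <-irrefl lt }) (λ { refl → <-irrefl u<u′ })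
                                   (on-column xu xu′ lt u<u′))
    ... | tri> _ _ u′<u = ⊥-elim (no-vertex-inside e∈ je (λ { refl → <-irrefl lt′ }) (λ { refl → <-irrefl u′<u })
                                   (on-column xu′ xu lt′ u′<u))

    lowerEnd-exists : ∀ {e} → e ∈ Es-vertical → ∃ (e HasLowerEnd_)
    lowerEnd-exists {i , j} e∈′ with ∈-filter⁻ vertical? e∈′
    ... | e∈ , xi≡xj with <-tri (y i) (y j)
    ...   | tri< lt _ _ = i , j , e∈ , inj₁ refl , sym xi≡xj , lt
    ...   | tri> _ _ gt = j , i , e∈ , inj₂ refl , xi≡xj , gt
    ...   | tri≈ _ yi≡yj _ = ⊥-elim (FinP.<-irrefl (point-injective xi≡xj yi≡yj) (All.lookup ordered e∈))

    vertical-bound : length Es-vertical ℕ.+ length tops ℕ.≤ n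
    vertical-bound = length+missed≤ _HasLowerEnd_ lowerEnd-injective (filter⁺ isTop? (allFin⁺ n))
      (λ (u , _ , _ , xu , lt) v∈ → proj₂ (∈-filter⁻ isTop? {xs = allFin n} v∈) u xu lt)
      (λ eq → eq) (filter⁺ vertical? unique) lowerEnd-exists

    module Nonvertical (ε : R) (sheared-injective : Injective _≡_ _≡_ (λ i → x i + ε * y i)) where

      x′ : Fin n → R
      x′ i = x i + ε * y i

      open PlaneGraph ℝ x′ y sheared-injective

      S : Fin n → Fin n → Set
      S i j = ((i , j) ∈ Es-nonvertical ⊎ (j , i) ∈ Es-nonvertical) × x′ i < x′ j

      open DecMembership (≡-dec (FinP._≟_ {n}) (FinP._≟_ {n})) using (_∈?_)

      S? : ∀ i j → Dec (S i j)
      S? i j = (((i , j) ∈? Es-nonvertical) ⊎-dec ((j , i) ∈? Es-nonvertical)) ×-dec (x′ i <? x′ j)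

      underlying : ∀ {i j} → S i j → ∃ λ e → e ∈ E × ¬ IsVertical e × Joins e i j
      underlying (inj₁ e∈ , _) = let e∈E , nv = ∈-filter⁻ nonvertical? e∈ in _ , e∈E , nv , inj₁ refl
      underlying (inj₂ e∈ , _) = let e∈E , nv = ∈-filter⁻ nonvertical? e∈ in _ , e∈E , nv , inj₂ refl

      -- The inverse shear takes the point of the sheared edge at abscissa `X` back to the drawing.
      -- Being affine, it preserves the parameter along the segment.
      unshear : ∀ {i j X} → x′ i < X → X < x′ j →
                OnOpenSeg (X - ε * height i j X , height i j X) (x i , y i) (x j , y j)
      unshear {i} {j} {X} i<X X<j =
        let 0<t , t<1 = ratio-∈ i<X X<j
        in t , 0<t , t<1 ,
           trans (cong₂ (λ a b → a - ε * b) (ratio-≡ (<-trans i<X X<j)) h≡)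
                 (solve 6 (λ xi xj yi yj ε t →
                    ((xi :+ ε :* yi) :+ t :* ((xj :+ ε :* yj) :- (xi :+ ε :* yi))) :- ε :* (yi :+ t :* (yj :- yi))
                    := xi :+ t :* (xj :- xi)) refl (x i) (x j) (y i) (y j) ε t) ,
           h≡
        where
          t = ratio (x′ i) (x′ j) X
          h≡ : height i j X ≡ y i + t * (y j - y i)
          h≡ = solve 4 (λ yi yj d i → yi :+ ((yj :- yi) :* i) :* d := yi :+ (d :* i) :* (yj :- yi)) refl
                 (y i) (y j) (X - x′ i) (inv (x′ j - x′ i))

      off-edge : ∀ {i j k} → S i j → x′ i < x′ k → x′ k < x′ j → height i j (x′ k) ≢ y k
      off-edge {i} {j} {k} s i<k k<j eq with underlying s
      ... | _ , e∈ , _ , je = no-vertex-inside e∈ je (λ { refl → <-irrefl i<k }) (λ { refl → <-irrefl k<j })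
        (subst (λ p → OnOpenSeg p (x i , y i) (x j , y j))
          (trans (cong (λ h → x′ k - ε * h , h) eq)
                 (cong (_, y k) (solve 3 (λ x ε y → (x :+ ε :* y) :- ε :* y := x) refl (x k) ε (y k))))
          (unshear i<k k<j))

      along : ∀ {e i j p} → Joins e i j → OnOpenSeg p (x i , y i) (x j , y j) →
              OnOpenSeg p (x (proj₁ e) , y (proj₁ e)) (x (proj₂ e) , y (proj₂ e))
      along (inj₁ refl) on = on
      along (inj₂ refl) on = open-flip on

      -- A crossing of two different edges would make one of them vertical.
      crossing⇒≡ : ∀ {e f} → e ∈ E → f ∈ E → ¬ IsVertical e → ¬ IsVertical f →
                   SegsCross (x (proj₁ e) , y (proj₁ e)) (x (proj₂ e) , y (proj₂ e))
                             (x (proj₁ f) , y (proj₁ f)) (x (proj₂ f) , y (proj₂ f)) → e ≡ f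
      crossing⇒≡ {e} {f} e∈ f∈ nv nv′ cross = decide (≡-dec FinP._≟_ FinP._≟_ e f)
        where
          decide : Dec (e ≡ f) → e ≡ f
          decide (yes e≡f) = e≡f
          decide (no e≢f) = ⊥-elim ([ (λ p → nv′ (proj₂ p)) , (λ p → nv (proj₁ p)) ]′ (axis-parallel e∈ f∈ e≢f cross))

      joins-oriented : ∀ {e i j k l} → x′ i < x′ j → x′ k < x′ l → Joins e i j → Joins e k l → i ≡ k × j ≡ l
      joins-oriented _   _   (inj₁ refl) (inj₁ refl) = refl , refl
      joins-oriented _   _   (inj₂ refl) (inj₂ refl) = refl , refl
      joins-oriented i<j k<l (inj₁ refl) (inj₂ refl) = ⊥-elim (<-irrefl (<-trans i<j k<l))
      joins-oriented i<j k<l (inj₂ refl) (inj₁ refl) = ⊥-elim (<-irrefl (<-trans i<j k<l))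

      disjoint : ∀ {i j k l X} → S i j → S k l → x′ i < X → X < x′ j → x′ k < X → X < x′ l →
                 height i j X ≡ height k l X → i ≡ k × j ≡ l
      disjoint {i} {j} {k} {l} {X} s s′ i<X X<j k<X X<l eq =
        let e , e∈ , nv , je = underlying s
            f , f∈ , nv′ , jf = underlying s′
            e≡f = crossing⇒≡ e∈ f∈ nv nv′ (_ , along je (unshear i<X X<j) ,
                    along jf (subst (λ h → OnOpenSeg (X - ε * h , h) (x k , y k) (x l , y l)) (sym eq) (unshear k<X X<l)))
        in joins-oriented (proj₂ s) (proj₂ s′) (subst (λ g → Joins g i j) e≡f je) jf

      orient : Fin n × Fin n → Fin n × Fin n
      orient (i , j) with x′ i <? x′ j
      ... | yes _ = i , j
      ... | no _  = j , i

      orient-joins : ∀ e → Joins e (proj₁ (orient e)) (proj₂ (orient e))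
      orient-joins (i , j) with x′ i <? x′ j
      ... | yes _ = inj₁ refl
      ... | no _  = inj₂ refl

      nonvertical∈E : ∀ {e} → e ∈ Es-nonvertical → e ∈ E
      nonvertical∈E e∈ = proj₁ (∈-filter⁻ nonvertical? e∈)

      orient-injective : ∀ {e f} → e ∈ Es-nonvertical → f ∈ Es-nonvertical → orient e ≡ orient f → e ≡ f
      orient-injective {e} {f} e∈ f∈ eq =
        joins-unique (nonvertical∈E e∈) (nonvertical∈E f∈)
          (subst (λ g → Joins e (proj₁ g) (proj₂ g)) eq (orient-joins e)) (orient-joins f)

      orient-S : ∀ {e} → e ∈ Es-nonvertical → S (proj₁ (orient e)) (proj₂ (orient e))
      orient-S {i , j} e∈ with x′ i <? x′ j
      ... | yes i<j = inj₁ e∈ , i<j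
      ... | no i≮j  = inj₂ e∈ , ≤∧≢⇒< i≮j λ eq →
            FinP.<-irrefl (sym (sheared-injective eq)) (All.lookup ordered (nonvertical∈E e∈))

      bound : 3 ℕ.≤ n → length Es-nonvertical ℕ.+ 6 ℕ.≤ n ℕ.* 3
      bound 3≤n = subst (λ k → k ℕ.+ 6 ℕ.≤ n ℕ.* 3) (length-map orient Es-nonvertical)
        (edge-bound S S? proj₂ off-edge disjoint 3≤n
          (map-unique-on orient-injective (filter⁺ nonvertical? unique))
          (λ e∈ → let f , f∈ , e≡ = ∈-map⁻ orient e∈
                  in subst (λ g → S (proj₁ g) (proj₂ g)) (sym e≡) (orient-S f∈)))

  edges+columns-bound : 3 ℕ.≤ n → length E ℕ.+ 6 ℕ.+ length tops ℕ.≤ 4 ℕ.* n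
  edges+columns-bound 3≤n = let ε , inj = Shear.generic-shear ℝ x y point-injective in begin
    length E ℕ.+ 6 ℕ.+ length tops
      ≡⟨ cong (λ m → m ℕ.+ 6 ℕ.+ length tops) (length-filter-split vertical? nonvertical? (λ v nv → nv v) (λ nv → nv) E) ⟩
    length Es-vertical ℕ.+ length Es-nonvertical ℕ.+ 6 ℕ.+ length tops
      ≡⟨ +-*-Solver.solve 3 (λ v h t → (v NS.:+ h NS.:+ NS.con 6 NS.:+ t) NS.:= ((h NS.:+ NS.con 6) NS.:+ (v NS.:+ t))) refl
           (length Es-vertical) (length Es-nonvertical) (length tops) ⟩
    (length Es-nonvertical ℕ.+ 6) ℕ.+ (length Es-vertical ℕ.+ length tops)
      ≤⟨ ℕP.+-mono-≤ (Nonvertical.bound ε inj 3≤n) vertical-bound ⟩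
    n ℕ.* 3 ℕ.+ n
      ≡⟨ +-*-Solver.solve 1 (λ n → (n NS.:* NS.con 3 NS.:+ n) NS.:= (NS.con 4 NS.:* n)) refl n ⟩
    4 ℕ.* n ∎
    where
      open ℕP.≤-Reasoning
      module NS = +-*-Solver

-- Upper bound: combining columns and rows.

apRAC-edge-bound : (ℝ : Reals) (n : ℕ) → 3 ℕ.≤ n → (G : Graph n) → Geometry.ZeroBendApRAC ℝ G →
              AtMost4n-√n-6 (numEdges G) n
apRAC-edge-bound ℝ n 3≤n G (D , _ , axis-parallel) =
  ℕP.≤-trans (ℕP.m≤m+n (m ℕ.+ 6) t) columns , (begin
    n      ≤⟨ columns*rows ℝ x y inj ⟩
    -- Both numbers are at most 4n - 6 - m, so their product is at most the square, and no root has
    -- to be taken.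
    t ℕ.* r ≤⟨ ℕP.*-mono-≤ (room t columns) (room r rows) ⟩
    (4 ℕ.* n ℕ.∸ 6 ℕ.∸ m) ℕ.* (4 ℕ.* n ℕ.∸ 6 ℕ.∸ m) ∎)
  where
    open Geometry ℝ
    open Segments ℝ
    open Drawing0 D
    open Graph G
    open ℕP.≤-Reasoning
    m = numEdges G
    x y : Fin n → Reals.R ℝ
    x i = proj₁ (pos i)
    y i = proj₂ (pos i)
    t = length (Columns.tops ℝ x y)
    r = length (Columns.tops ℝ y x)
    inj : ∀ {i j} → x i ≡ x j → y i ≡ y j → i ≡ j
    inj p q = pos-inj (cong₂ _,_ p q)
    columns : m ℕ.+ 6 ℕ.+ t ℕ.≤ 4 ℕ.* n
    columns = ApRAC.edges+columns-bound ℝ x y inj edges ordered unique no-pass axis-parallel 3≤n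
    rows : m ℕ.+ 6 ℕ.+ r ℕ.≤ 4 ℕ.* n
    -- The rows are the columns of the reflected drawing. Reflection exchanges horizontal and
    -- vertical, hence `Sum.swap`.
    rows = ApRAC.edges+columns-bound ℝ y x (λ p q → inj q p) edges ordered unique
      (λ e∈ k k≢i k≢j on → no-pass e∈ k k≢i k≢j (closed-swap on))
      (λ e∈ f∈ e≢f ((px , py) , on , on′) → Sum.swap (axis-parallel e∈ f∈ e≢f ((py , px) , open-swap on , open-swap on′)))
      3≤n
    room : ∀ k → m ℕ.+ 6 ℕ.+ k ℕ.≤ 4 ℕ.* n → k ℕ.≤ 4 ℕ.* n ℕ.∸ 6 ℕ.∸ m
    room k le = ℕP.m+n≤o⇒m≤o∸n k (ℕP.m+n≤o⇒m≤o∸n (k ℕ.+ m) (subst (ℕ._≤ 4 ℕ.* n) (rearrange m k) le))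
      where module NS = +-*-Solver
            rearrange = +-*-Solver.solve 2 (λ m k → (m NS.:+ NS.con 6 NS.:+ k) NS.:= (k NS.:+ m NS.:+ NS.con 6)) refl

-- Lower bound: monotonicity of linear interpolation.

module Interpolation (ℝ : Reals) where
  open Reals ℝ
  open OrderedField ℝ

  lerp : R → R → R → R
  lerp t A B = A + t * (B - A)

  lerp-const : ∀ t A → lerp t A A ≡ A
  lerp-const = solve 2 (λ t A → A :+ t :* (A :- A) := A) refl

  module _ {t : R} (0<t : 0r < t) (t<1 : t < 1r) where

    lerp-mono-≤-< : ∀ {A A′ B B′} → A ≤ A′ → B < B′ → lerp t A B < lerp t A′ B′
    lerp-mono-≤-< {A} {A′} {B} {B′} A≤A′ B<B′ with ≤⇒<⊎≡ A≤A′
    ... | inj₁ A<A′ = 0<⇒< (+-pos (*-pos (<⇒0<- t<1) (<⇒0<- A<A′)) (*-pos 0<t (<⇒0<- B<B′)))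
      (solve 5 (λ t A A′ B B′ → (:1 :- t) :* (A′ :- A) :+ t :* (B′ :- B) :=
         (A′ :+ t :* (B′ :- A′)) :- (A :+ t :* (B :- A))) refl t A A′ B B′)
    ... | inj₂ refl = 0<⇒< (*-pos 0<t (<⇒0<- B<B′))
      (solve 4 (λ t A B B′ → t :* (B′ :- B) := (A :+ t :* (B′ :- A)) :- (A :+ t :* (B :- A))) refl t A B B′)

    lerp-mono-<-≤ : ∀ {A A′ B B′} → A < A′ → B ≤ B′ → lerp t A B < lerp t A′ B′
    lerp-mono-<-≤ {A} {A′} {B} {B′} A<A′ B≤B′ with ≤⇒<⊎≡ B≤B′
    ... | inj₁ B<B′ = lerp-mono-≤-< (<⇒≤ A<A′) B<B′
    ... | inj₂ refl = 0<⇒< (*-pos (<⇒0<- t<1) (<⇒0<- A<A′))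
      (solve 4 (λ t A A′ B → (:1 :- t) :* (A′ :- A) := (A′ :+ t :* (B :- A′)) :- (A :+ t :* (B :- A))) refl t A A′ B)

    lerp-monoˡ-≤ : ∀ {A A′ B} → A ≤ A′ → lerp t A B ≤ lerp t A′ B
    lerp-monoˡ-≤ A≤A′ with ≤⇒<⊎≡ A≤A′
    ... | inj₁ A<A′ = <⇒≤ (lerp-mono-<-≤ A<A′ ≤-refl)
    ... | inj₂ refl = ≤-refl

    lerp-increasing : ∀ {A B} → A < B → A < lerp t A B × lerp t A B < B
    lerp-increasing {A} {B} A<B = subst (_< lerp t A B) (lerp-const t A) (lerp-mono-≤-< ≤-refl A<B) ,
                                  subst (lerp t A B <_) (lerp-const t B) (lerp-mono-<-≤ A<B ≤-refl)

    lerp-decreasing : ∀ {A B} → B < A → B < lerp t A B × lerp t A B < A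
    lerp-decreasing {A} {B} B<A = subst (_< lerp t A B) (lerp-const t B) (lerp-mono-<-≤ B<A ≤-refl) ,
                                  subst (lerp t A B <_) (lerp-const t A) (lerp-mono-≤-< ≤-refl B<A)

    lerp-≥ : ∀ {A B c} → c ≤ A → c ≤ B → c ≤ lerp t A B
    lerp-≥ {A} {B} c≤A c≤B with <-tri A B
    ... | tri< A<B _ _  = ≤-trans c≤A (<⇒≤ (proj₁ (lerp-increasing A<B)))
    ... | tri≈ _ refl _ = subst (_ ≤_) (sym (lerp-const t A)) c≤A
    ... | tri> _ _ B<A  = ≤-trans c≤B (<⇒≤ (proj₁ (lerp-decreasing B<A)))

    lerp-≤ : ∀ {A B c} → A ≤ c → B ≤ c → lerp t A B ≤ c
    lerp-≤ {A} {B} A≤c B≤c with <-tri A B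
    ... | tri< A<B _ _  = ≤-trans (<⇒≤ (proj₂ (lerp-increasing A<B))) B≤c
    ... | tri≈ _ refl _ = subst (_≤ _) (sym (lerp-const t A)) A≤c
    ... | tri> _ _ B<A  = ≤-trans (<⇒≤ (proj₂ (lerp-decreasing B<A))) A≤c

  lerp-mono-t : ∀ {t t′ A B} → t < t′ → A < B → lerp t A B < lerp t′ A B
  lerp-mono-t {t} {t′} {A} {B} t<t′ A<B = 0<⇒< (*-pos (<⇒0<- t<t′) (<⇒0<- A<B))
    (solve 4 (λ t t′ A B → (t′ :- t) :* (B :- A) := (A :+ t′ :* (B :- A)) :- (A :+ t :* (B :- A))) refl t t′ A B)

  lerp-anti-t : ∀ {t t′ A B} → t < t′ → B < A → lerp t′ A B < lerp t A B
  lerp-anti-t {t} {t′} {A} {B} t<t′ B<A = 0<⇒< (*-pos (<⇒0<- t<t′) (<⇒0<- B<A))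
    (solve 4 (λ t t′ A B → (t′ :- t) :* (A :- B) := (A :+ t :* (B :- A)) :- (A :+ t′ :* (B :- A))) refl t t′ A B)

  -- Controls the sum of the coordinates along a segment, by which the edge between the apices is
  -- separated from the other edges.
  lerp-+ : ∀ t A B C D → lerp t A B + lerp t C D ≡ lerp t (A + C) (B + D)
  lerp-+ = solve 5 (λ t A B C D → (A :+ t :* (B :- A)) :+ (C :+ t :* (D :- C)) :=
                                  (A :+ C) :+ t :* ((B :+ D) :- (A :+ C))) refl

-- Lower bound: integer grid coordinates in the field.

module Naturals (ℝ : Reals) where
  open Reals ℝ
  open OrderedField ℝ

  abstract
    ι : ℕ → R
    ι = fromℕ

    ι-suc : ∀ n → ι (suc n) ≡ 1r + ι n
    ι-suc = fromℕ-suc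

    ι-+ : ∀ m n → ι (m ℕ.+ n) ≡ ι m + ι n
    ι-+ = fromℕ-+

  -- Adding and subtracting the coordinates of (a - b , a + b) gives 2a and 2b; keeping the factor
  -- two avoids division.
  κ : ℕ → R
  κ n = ι n + ι n

  κ-+ : ∀ m n → κ (m ℕ.+ n) ≡ κ m + κ n
  κ-+ m n = trans (cong (λ z → z + z) (ι-+ m n))
    (solve 2 (λ a b → (a :+ b) :+ (a :+ b) := (a :+ a) :+ (b :+ b)) refl (ι m) (ι n))

  κ-0 : κ 0 ≡ 0r
  κ-0 = trans (solve 1 (λ k → k := (k :+ k) :- k) refl (κ 0))
              (trans (cong (λ z → z - κ 0) (sym (κ-+ 0 0))) (+-invʳ (κ 0)))

  +κ0 : ∀ X → X + κ 0 ≡ X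
  +κ0 X = trans (cong (X +_) κ-0) (+-idʳ X)

  κ-step : ∀ n → κ n < κ (suc n)
  κ-step n = 0<⇒< (+-pos 0<1 0<1) (sym (trans (cong (λ z → (z + z) - κ n) (ι-suc n))
    (solve 1 (λ a → ((:1 :+ a) :+ (:1 :+ a)) :- (a :+ a) := :1 :+ :1) refl (ι n))))

  κ-mono-< : ∀ {m n} → m ℕ.< n → κ m < κ n
  κ-mono-< {m} {suc n} (s≤s m≤n) with ℕP.m≤n⇒m<n∨m≡n m≤n
  ... | inj₁ m<n  = <-trans (κ-mono-< m<n) (κ-step n)
  ... | inj₂ refl = κ-step n

  κ-mono-≤ : ∀ {m n} → m ℕ.≤ n → κ m ≤ κ n
  κ-mono-≤ m≤n with ℕP.m≤n⇒m<n∨m≡n m≤n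
  ... | inj₁ m<n  = <⇒≤ (κ-mono-< m<n)
  ... | inj₂ refl = ≤-refl

  κ-injective : ∀ {m n} → κ m ≡ κ n → m ≡ n
  κ-injective {m} {n} eq with ℕP.<-cmp m n
  ... | tri< m<n _ _ = ⊥-elim (<⇒≢ (κ-mono-< m<n) eq)
  ... | tri≈ _ m≡n _ = m≡n
  ... | tri> _ _ n<m = ⊥-elim (>⇒≢ (κ-mono-< n<m) eq)

  -- The points `κ a` and the open intervals between neighbouring ones are pairwise disjoint.
  -- Products of two of them are the vertices, open sides and open squares of the grid.
  InCell : ℕ → Bool → R → Set
  InCell a true  X = κ a < X × X < κ (suc a)
  InCell a false X = X ≡ κ a

  private
    cell-floor : ∀ {a d X} → InCell a d X → κ a ≤ X × X < κ (suc a)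
    cell-floor {d = true} (lt , gt) = <⇒≤ lt , gt
    cell-floor {a} {false} refl = ≤-refl , κ-step a

  cell-unique : ∀ {a d a′ d′ X} → InCell a d X → InCell a′ d′ X → (a , d) ≡ (a′ , d′)
  cell-unique {a} {d} {a′} {d′} c c′ with ℕP.<-cmp a a′
  ... | tri< a<a′ _ _ = ⊥-elim (≤-trans (κ-mono-≤ a<a′) (proj₁ (cell-floor {d = d′} c′)) (proj₂ (cell-floor {d = d} c)))
  ... | tri> _ _ a′<a = ⊥-elim (≤-trans (κ-mono-≤ a′<a) (proj₁ (cell-floor {d = d} c)) (proj₂ (cell-floor {d = d′} c′)))
  cell-unique {d = true}  {d′ = true}  c c′ | tri≈ _ refl _ = refl
  cell-unique {d = false} {d′ = false} c c′ | tri≈ _ refl _ = refl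
  cell-unique {d = true}  {d′ = false} (lt , _) refl | tri≈ _ refl _ = ⊥-elim (<-irrefl lt)
  cell-unique {d = false} {d′ = true}  refl (lt , _) | tri≈ _ refl _ = ⊥-elim (<-irrefl lt)

-- Lower bound: combinatorics of the graph.

-- The king's graph on an s × s grid, s = m + 1, with rows and columns numbered from 1, drawn
-- rotated by 45°, together with two apices, (2 s + 1 , 0) and (0 , 2 s + 1), each joined to the
-- two sides of the grid that it sees and to the other apex.
module KingGraph (m : ℕ) where

  s n : ℕ
  s = suc m
  n = s ℕ.* s ℕ.+ 2

  Vertex : Set
  Vertex = (Fin s × Fin s) ⊎ Fin 2

  pattern grid a b = inj₁ (a , b)
  pattern apex₁ = inj₂ zero
  pattern apex₂ = inj₂ (suc zero)

  vertex↔Fin : Fin n ↔ Vertex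
  vertex↔Fin = (FinP.*↔× ⊎-↔ ↔-id (Fin 2)) ↔-∘ FinP.+↔⊎

  -- The two sides seen by an apex share a corner, which is listed in the first summand only; hence
  -- `m` instead of `s` in the second.
  Side : Set
  Side = Fin s ⊎ Fin m

  InnerEdge : Set
  InnerEdge = (Fin m × Fin s) ⊎ (Fin s × Fin m) ⊎ (Fin m × Fin m) ⊎ (Fin m × Fin m)

  pattern right a b = inj₁ (a , b)
  pattern up a b    = inj₂ (inj₁ (a , b))
  pattern diag a b  = inj₂ (inj₂ (inj₁ (a , b)))
  pattern anti a b  = inj₂ (inj₂ (inj₂ (a , b)))

  Edge : Set
  Edge = InnerEdge ⊎ (Side ⊎ Side ⊎ Fin 1)

  pattern inner e = inj₁ e
  pattern ray₁ q  = inj₂ (inj₁ q)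
  pattern ray₂ q  = inj₂ (inj₂ (inj₁ q))
  pattern top     = inj₂ (inj₂ (inj₂ zero))

  #edges : ℕ
  #edges = (m ℕ.* s ℕ.+ (s ℕ.* m ℕ.+ (m ℕ.* m ℕ.+ m ℕ.* m))) ℕ.+ ((s ℕ.+ m) ℕ.+ ((s ℕ.+ m) ℕ.+ 1))

  edge↔Fin : Fin #edges ↔ Edge
  edge↔Fin = (((FinP.*↔× ⊎-↔ ((FinP.*↔× ⊎-↔ ((FinP.*↔× ⊎-↔ FinP.*↔×) ↔-∘ FinP.+↔⊎)) ↔-∘ FinP.+↔⊎)) ↔-∘ FinP.+↔⊎)
               ⊎-↔ ((FinP.+↔⊎ ⊎-↔ ((FinP.+↔⊎ ⊎-↔ ↔-id (Fin 1)) ↔-∘ FinP.+↔⊎)) ↔-∘ FinP.+↔⊎)) ↔-∘ FinP.+↔⊎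

  code : Vertex → Fin n
  code = Inverse.from vertex↔Fin

  decode : Fin n → Vertex
  decode = Inverse.to vertex↔Fin

  decode-code : ∀ v → decode (code v) ≡ v
  decode-code = Inverse.strictlyInverseˡ vertex↔Fin

  decode-injective : ∀ {i j} → decode i ≡ decode j → i ≡ j
  decode-injective {i} {j} eq = trans (sym (Inverse.strictlyInverseʳ vertex↔Fin i))
    (trans (cong code eq) (Inverse.strictlyInverseʳ vertex↔Fin j))

  side₁ side₂ : Side → Vertex
  side₁ (inj₁ b) = grid (Fin.fromℕ m) b
  side₁ (inj₂ a) = grid (inject₁ a) zero
  side₂ (inj₁ a) = grid a (Fin.fromℕ m)
  side₂ (inj₂ b) = grid zero (inject₁ b)

  src tgt : Edge → Vertex
  src (inner (right a b)) = grid (inject₁ a) b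
  src (inner (up a b))    = grid a (inject₁ b)
  src (inner (diag a b))  = grid (inject₁ a) (inject₁ b)
  src (inner (anti a b))  = grid (inject₁ a) (suc b)
  src (ray₁ q)            = side₁ q
  src (ray₂ q)            = side₂ q
  src top                 = apex₁
  tgt (inner (right a b)) = grid (suc a) b
  tgt (inner (up a b))    = grid a (suc b)
  tgt (inner (diag a b))  = grid (suc a) (suc b)
  tgt (inner (anti a b))  = grid (suc a) (inject₁ b)
  tgt (ray₁ q)            = apex₁
  tgt (ray₂ q)            = apex₂
  tgt top                 = apex₂

  private
    inject₁<suc : ∀ {k} (a : Fin k) → inject₁ a Fin.< suc a
    inject₁<suc a = subst (ℕ._< suc (toℕ a)) (sym (FinP.toℕ-inject₁ a)) ℕP.≤-refl

    ↑ˡ-mono-< : ∀ {i j : Fin (s ℕ.* s)} → i Fin.< j → (i Fin.↑ˡ 2) Fin.< (j Fin.↑ˡ 2)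
    ↑ˡ-mono-< {i} {j} = subst₂ ℕ._<_ (sym (FinP.toℕ-↑ˡ i 2)) (sym (FinP.toℕ-↑ˡ j 2))

    code-monoˡ : ∀ {a a′ b b′} → a Fin.< a′ → code (grid a b) Fin.< code (grid a′ b′)
    code-monoˡ {b = b} {b′} a<a′ = ↑ˡ-mono-< (FinP.combine-monoˡ-< b b′ a<a′)

    code-monoʳ : ∀ {a b b′} → b Fin.< b′ → code (grid a b) Fin.< code (grid a b′)
    code-monoʳ {a} {b} {b′} b<b′ = ↑ˡ-mono-<
      (subst₂ ℕ._<_ (sym (FinP.toℕ-combine a b)) (sym (FinP.toℕ-combine a b′)) (ℕP.+-monoʳ-< (s ℕ.* toℕ a) b<b′))

    grid<apex : ∀ {a b} k → code (grid a b) Fin.< code (inj₂ k)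
    grid<apex {a} {b} k = ℕP.<-≤-trans
      (subst (ℕ._< s ℕ.* s) (sym (FinP.toℕ-↑ˡ (Fin.combine a b) 2)) (FinP.toℕ<n (Fin.combine a b)))
      (subst (s ℕ.* s ℕ.≤_) (sym (FinP.toℕ-↑ʳ (s ℕ.* s) k)) (ℕP.m≤m+n _ _))

  -- `code` orders the grid lexicographically and puts the apices last. This is why an antidiagonal
  -- is directed so that its first coordinate increases.
  src<tgt : ∀ e → code (src e) Fin.< code (tgt e)
  src<tgt (inner (right a b)) = code-monoˡ {b = b} {b} (inject₁<suc a)
  src<tgt (inner (up a b))    = code-monoʳ {a} (inject₁<suc b)
  src<tgt (inner (diag a b))  = code-monoˡ {b = inject₁ b} {suc b} (inject₁<suc a)
  src<tgt (inner (anti a b))  = code-monoˡ {b = suc b} {inject₁ b} (inject₁<suc a)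
  src<tgt (ray₁ (inj₁ b))     = grid<apex {Fin.fromℕ m} {b} zero
  src<tgt (ray₁ (inj₂ a))     = grid<apex {inject₁ a} {zero} zero
  src<tgt (ray₂ (inj₁ a))     = grid<apex {a} {Fin.fromℕ m} (suc zero)
  src<tgt (ray₂ (inj₂ b))     = grid<apex {zero} {inject₁ b} (suc zero)
  src<tgt top                 = subst₂ ℕ._<_ (sym (FinP.toℕ-↑ʳ {2} (s ℕ.* s) zero)) (sym (FinP.toℕ-↑ʳ {2} (s ℕ.* s) (suc zero)))
                                  (ℕP.+-monoʳ-< (s ℕ.* s) (s≤s z≤n))

  coord : Vertex → ℕ × ℕ
  coord (grid a b) = suc (toℕ a) , suc (toℕ b)
  -- One more than the largest coordinate sum in the grid, so that the edge joining the apices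
  -- clears the grid; the coordinate 0 lies just before the first row.
  coord apex₁      = suc (s ℕ.+ s) , 0
  coord apex₂      = 0 , suc (s ℕ.+ s)

  coord-injective : ∀ {v w} → coord v ≡ coord w → v ≡ w
  coord-injective {grid a b} {grid a′ b′} eq =
    cong₂ grid (FinP.toℕ-injective (ℕP.suc-injective (cong proj₁ eq)))
               (FinP.toℕ-injective (ℕP.suc-injective (cong proj₂ eq)))
  coord-injective {grid _ _} {apex₁}    eq with () ← cong proj₂ eq
  coord-injective {grid _ _} {apex₂}    eq with () ← cong proj₁ eq
  coord-injective {apex₁}    {grid _ _} eq with () ← cong proj₂ eq
  coord-injective {apex₁}    {apex₁}    eq = refl
  coord-injective {apex₁}    {apex₂}    eq with () ← cong proj₁ eq
  coord-injective {apex₂}    {grid _ _} eq with () ← cong proj₁ eq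
  coord-injective {apex₂}    {apex₁}    eq with () ← cong proj₁ eq
  coord-injective {apex₂}    {apex₂}    eq = refl

  -- Coordinates of the side vertices of the first apex. Those of the second arise by exchanging the
  -- two, so only rays to the first apex need study.
  α β : Side → ℕ
  α (inj₁ b) = s
  α (inj₂ a) = suc (toℕ a)
  β (inj₁ b) = suc (toℕ b)
  β (inj₂ a) = 1

  coord-side₁ : ∀ q → coord (side₁ q) ≡ (α q , β q)
  coord-side₁ (inj₁ b) = cong (λ k → suc k , suc (toℕ b)) (FinP.toℕ-fromℕ m)
  coord-side₁ (inj₂ a) = cong (λ k → suc k , 1) (FinP.toℕ-inject₁ a)

  coord-side₂ : ∀ q → coord (side₂ q) ≡ (β q , α q)
  coord-side₂ (inj₁ b) = cong (λ k → suc (toℕ b) , suc k) (FinP.toℕ-fromℕ m)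
  coord-side₂ (inj₂ a) = cong (λ k → 1 , suc k) (FinP.toℕ-inject₁ a)

  -- The two sides run from (1 , 1) through (s , 1) to (s , s), a chain in the componentwise order.
  -- This orders the rays around the apex.
  side-comparable : ∀ q r → (α q ℕ.≤ α r × β q ℕ.≤ β r) ⊎ (α r ℕ.≤ α q × β r ℕ.≤ β q)
  side-comparable (inj₁ b) (inj₁ b′) with ℕP.≤-total (toℕ b) (toℕ b′)
  ... | inj₁ le = inj₁ (ℕP.≤-refl , s≤s le)
  ... | inj₂ ge = inj₂ (ℕP.≤-refl , s≤s ge)
  side-comparable (inj₂ a) (inj₂ a′) with ℕP.≤-total (toℕ a) (toℕ a′)
  ... | inj₁ le = inj₁ (s≤s le , ℕP.≤-refl)
  ... | inj₂ ge = inj₂ (s≤s ge , ℕP.≤-refl)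
  side-comparable (inj₁ b) (inj₂ a) = inj₂ (s≤s (ℕP.<⇒≤ (FinP.toℕ<n a)) , s≤s z≤n)
  side-comparable (inj₂ a) (inj₁ b) = inj₁ (s≤s (ℕP.<⇒≤ (FinP.toℕ<n a)) , s≤s z≤n)

  side-injective : ∀ q r → α q ≡ α r → β q ≡ β r → q ≡ r
  side-injective (inj₁ b) (inj₁ b′) _ eq = cong inj₁ (FinP.toℕ-injective (ℕP.suc-injective eq))
  side-injective (inj₂ a) (inj₂ a′) eq _ = cong inj₂ (FinP.toℕ-injective (ℕP.suc-injective eq))
  side-injective (inj₁ b) (inj₂ a) eq _ = ⊥-elim (ℕP.<-irrefl (sym (ℕP.suc-injective eq)) (FinP.toℕ<n a))
  side-injective (inj₂ a) (inj₁ b) eq _ = ⊥-elim (ℕP.<-irrefl (ℕP.suc-injective eq) (FinP.toℕ<n a))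

  β≤α : ∀ q → β q ℕ.≤ α q
  β≤α (inj₁ b) = FinP.toℕ<n b
  β≤α (inj₂ a) = s≤s z≤n

  α≤s : ∀ q → α q ℕ.≤ s
  α≤s (inj₁ b) = ℕP.≤-refl
  α≤s (inj₂ a) = s≤s (ℕP.<⇒≤ (FinP.toℕ<n a))

  0<β : ∀ q → 0 ℕ.< β q
  0<β (inj₁ b) = s≤s z≤n
  0<β (inj₂ a) = s≤s z≤n

  on-boundary : ∀ q → α q ≡ s ⊎ β q ≡ 1
  on-boundary (inj₁ b) = inj₁ refl
  on-boundary (inj₂ a) = inj₂ refl

  -- The cell that contains the interior of the edge. Only the two diagonals of a square share a
  -- cell, which is why no other inner edges cross.
  cellOf : InnerEdge → (ℕ × Bool) × (ℕ × Bool)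
  cellOf (right a b) = (suc (toℕ a) , true)  , (suc (toℕ b) , false)
  cellOf (up a b)    = (suc (toℕ a) , false) , (suc (toℕ b) , true)
  cellOf (diag a b)  = (suc (toℕ a) , true)  , (suc (toℕ b) , true)
  cellOf (anti a b)  = (suc (toℕ a) , true)  , (suc (toℕ b) , true)

  IsDiag IsAnti : Edge → Set
  IsDiag e = ∃ λ a → ∃ λ b → e ≡ inner (diag a b)
  IsAnti e = ∃ λ a → ∃ λ b → e ≡ inner (anti a b)

  private
    toℕ-inj : ∀ {k l} {a a′ : Fin k} {b b′ : Fin l} {d d′ e e′ : Bool} →
              _≡_ {A = (ℕ × Bool) × (ℕ × Bool)}
                ((suc (toℕ a) , d) , (suc (toℕ b) , e)) ((suc (toℕ a′) , d′) , (suc (toℕ b′) , e′)) →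
              (a , b) ≡ (a′ , b′)
    toℕ-inj eq = cong₂ _,_ (FinP.toℕ-injective (ℕP.suc-injective (cong (λ c → proj₁ (proj₁ c)) eq)))
                           (FinP.toℕ-injective (ℕP.suc-injective (cong (λ c → proj₁ (proj₂ c)) eq)))

    bits : (ℕ × Bool) × (ℕ × Bool) → Bool × Bool
    bits ((_ , d) , (_ , e)) = d , e

  same-cell : ∀ e f → cellOf e ≡ cellOf f →
              e ≡ f ⊎ (IsAnti (inner e) × IsDiag (inner f)) ⊎ (IsDiag (inner e) × IsAnti (inner f))
  same-cell (right a b) (right a′ b′) eq = inj₁ (cong inj₁ (toℕ-inj eq))
  same-cell (right a b) (up a′ b′)    eq with () ← cong bits eq
  same-cell (right a b) (diag a′ b′)  eq with () ← cong bits eq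
  same-cell (right a b) (anti a′ b′)  eq with () ← cong bits eq
  same-cell (up a b)    (right a′ b′) eq with () ← cong bits eq
  same-cell (up a b)    (up a′ b′)    eq = inj₁ (cong (λ p → inj₂ (inj₁ p)) (toℕ-inj eq))
  same-cell (up a b)    (diag a′ b′)  eq with () ← cong bits eq
  same-cell (up a b)    (anti a′ b′)  eq with () ← cong bits eq
  same-cell (diag a b)  (right a′ b′) eq with () ← cong bits eq
  same-cell (diag a b)  (up a′ b′)    eq with () ← cong bits eq
  same-cell (diag a b)  (diag a′ b′)  eq = inj₁ (cong (λ p → inj₂ (inj₂ (inj₁ p))) (toℕ-inj eq))
  same-cell (diag a b)  (anti a′ b′)  eq = inj₂ (inj₂ ((a , b , refl) , (a′ , b′ , refl)))
  same-cell (anti a b)  (right a′ b′) eq with () ← cong bits eq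
  same-cell (anti a b)  (up a′ b′)    eq with () ← cong bits eq
  same-cell (anti a b)  (diag a′ b′)  eq = inj₂ (inj₁ ((a , b , refl) , (a′ , b′ , refl)))
  same-cell (anti a b)  (anti a′ b′)  eq = inj₁ (cong (λ p → inj₂ (inj₂ (inj₂ p))) (toℕ-inj eq))

  -- Two `false` flags mark a point with grid coordinates, and every vertex is such a point; so
  -- inner edges pass through no vertex.
  true-bit : ∀ e {a b} → cellOf e ≢ ((a , false) , (b , false))
  true-bit (right _ _) eq with () ← cong bits eq
  true-bit (up _ _)    eq with () ← cong bits eq
  true-bit (diag _ _)  eq with () ← cong bits eq
  true-bit (anti _ _)  eq with () ← cong bits eq

-- Lower bound: the drawing and its crossings.

module KingDrawing (ℝ : Reals) (m : ℕ) where
  open Reals ℝ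
  open OrderedField ℝ
  open Geometry ℝ
  open Interpolation ℝ
  open Naturals ℝ
  open KingGraph m

  -- Rotation by 45° with scaling by √2: the direction (1 , 1) becomes vertical and (1 , -1)
  -- horizontal.
  place : ℕ × ℕ → Point
  place (a , b) = ι a - ι b , ι a + ι b

  -- The rotated coordinates of a point, in which place (a , b) is (κ a , κ b).
  u-of v-of : Point → R
  u-of (px , py) = px + py
  v-of (px , py) = py - px

  u-place : ∀ c → u-of (place c) ≡ κ (proj₁ c)
  u-place (a , b) = solve 2 (λ a b → (a :- b) :+ (a :+ b) := a :+ a) refl (ι a) (ι b)

  v-place : ∀ c → v-of (place c) ≡ κ (proj₂ c)
  v-place (a , b) = solve 2 (λ a b → (a :+ b) :- (a :- b) := b :+ b) refl (ι a) (ι b)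

  place-injective : ∀ {c d} → place c ≡ place d → c ≡ d
  place-injective {c} {d} eq = cong₂ _,_
    (κ-injective (trans (sym (u-place c)) (trans (cong u-of eq) (u-place d))))
    (κ-injective (trans (sym (v-place c)) (trans (cong v-of eq) (v-place d))))

  OnSeg : ℕ × ℕ → ℕ × ℕ → R → R → Set
  OnSeg (a , b) (c , d) U V = ∃ λ t → 0r < t × t < 1r × U ≡ lerp t (κ a) (κ c) × V ≡ lerp t (κ b) (κ d)

  rotate : ∀ {p} c d → OnOpenSeg p (place c) (place d) → OnSeg c d (u-of p) (v-of p)
  rotate (a , b) (c , d) (t , 0<t , t<1 , refl , refl) = t , 0<t , t<1 ,
    solve 5 (λ a b c d t → ((a :- b) :+ t :* ((c :- d) :- (a :- b))) :+ ((a :+ b) :+ t :* ((c :+ d) :- (a :+ b)))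
               := (a :+ a) :+ t :* ((c :+ c) :- (a :+ a))) refl (ι a) (ι b) (ι c) (ι d) t ,
    solve 5 (λ a b c d t → ((a :+ b) :+ t :* ((c :+ d) :- (a :+ b))) :- ((a :- b) :+ t :* ((c :- d) :- (a :- b)))
               := (b :+ b) :+ t :* ((d :+ d) :- (b :+ b))) refl (ι a) (ι b) (ι c) (ι d) t

  swap-seg : ∀ {a b c d U V} → OnSeg (a , b) (c , d) U V → OnSeg (b , a) (d , c) V U
  swap-seg (t , 0<t , t<1 , eU , eV) = t , 0<t , t<1 , eV , eU

  OnEdge : Edge → R → R → Set
  OnEdge e = OnSeg (coord (src e)) (coord (tgt e))

  private
    step : ∀ a {t} → 0r < t → t < 1r → InCell a true (lerp t (κ a) (κ (suc a)))
    step a 0<t t<1 = lerp-increasing 0<t t<1 (κ-step a)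

    back : ∀ a {t} → 0r < t → t < 1r → InCell a true (lerp t (κ (suc a)) (κ a))
    back a 0<t t<1 = lerp-decreasing 0<t t<1 (κ-step a)

  inner-cell : ∀ e {U V} → OnEdge (inner e) U V →
               uncurry InCell (proj₁ (cellOf e)) U × uncurry InCell (proj₂ (cellOf e)) V
  inner-cell (right a b) (t , 0<t , t<1 , refl , refl) rewrite FinP.toℕ-inject₁ a =
    step _ 0<t t<1 , lerp-const t _
  inner-cell (up a b) (t , 0<t , t<1 , refl , refl) rewrite FinP.toℕ-inject₁ b =
    lerp-const t _ , step _ 0<t t<1
  inner-cell (diag a b) (t , 0<t , t<1 , refl , refl) rewrite FinP.toℕ-inject₁ a | FinP.toℕ-inject₁ b =
    step _ 0<t t<1 , step _ 0<t t<1
  inner-cell (anti a b) (t , 0<t , t<1 , refl , refl) rewrite FinP.toℕ-inject₁ a | FinP.toℕ-inject₁ b =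
    step _ 0<t t<1 , back _ 0<t t<1

  InSquare : R → R → Set
  InSquare U V = (κ 1 ≤ U × U ≤ κ s) × (κ 1 ≤ V × V ≤ κ s)

  grid-range : ∀ (a : Fin s) → κ 1 ≤ κ (suc (toℕ a)) × κ (suc (toℕ a)) ≤ κ s
  grid-range a = κ-mono-≤ (s≤s z≤n) , κ-mono-≤ (FinP.toℕ<n a)

  grid-seg : ∀ {a b c d : Fin s} {U V} → OnSeg (coord (grid a b)) (coord (grid c d)) U V → InSquare U V
  grid-seg {a} {b} {c} {d} (t , 0<t , t<1 , refl , refl) = range a c , range b d
    where
      range : ∀ (i j : Fin s) → κ 1 ≤ lerp t (κ (suc (toℕ i))) (κ (suc (toℕ j))) ×
                                lerp t (κ (suc (toℕ i))) (κ (suc (toℕ j))) ≤ κ s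
      range i j = lerp-≥ 0<t t<1 (proj₁ (grid-range i)) (proj₁ (grid-range j)) ,
                  lerp-≤ 0<t t<1 (proj₂ (grid-range i)) (proj₂ (grid-range j))

  inner-square : ∀ e {U V} → OnEdge (inner e) U V → InSquare U V
  inner-square (right a b) = grid-seg {inject₁ a} {b} {suc a} {b}
  inner-square (up a b)    = grid-seg {a} {inject₁ b} {a} {suc b}
  inner-square (diag a b)  = grid-seg {inject₁ a} {inject₁ b} {suc a} {suc b}
  inner-square (anti a b)  = grid-seg {inject₁ a} {suc b} {suc a} {inject₁ b}

  apexSum : R
  apexSum = κ (suc (s ℕ.+ s))

  square-sum : ∀ {U V} → InSquare U V → U + V < apexSum
  square-sum ((_ , U≤) , (_ , V≤)) = ≤-<-trans (+-mono-≤ U≤ V≤)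
    (subst (_< apexSum) (κ-+ s s) (κ-step (s ℕ.+ s)))

  -- The half-planes beyond the two sides seen by the first apex; with the arguments exchanged,
  -- those for the second.
  OutsideSquare : R → R → Set
  OutsideSquare U V = κ s < U ⊎ V < κ 1

  outside : ∀ {U V} → InSquare U V → OutsideSquare U V → ⊥
  outside ((_ , U≤) , _) (inj₁ lt) = U≤ lt
  outside (_ , (V≥ , _)) (inj₂ lt) = V≥ lt

  outside-swap : ∀ {U V} → InSquare U V → OutsideSquare V U → ⊥
  outside-swap (u , v) = outside (v , u)

  OnRay : Side → R → R → Set
  OnRay q = OnSeg (α q , β q) (coord apex₁)

  -- A ray leaves the side on which it starts at once: `U` increases from `κ s`, or `V` decreases
  -- from `κ 1`.
  ray-outside : ∀ q {U V} → OnRay q U V → OutsideSquare U V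
  ray-outside q (t , 0<t , t<1 , refl , refl) with on-boundary q
  ... | inj₁ α≡s rewrite α≡s = inj₁ (proj₁ (lerp-increasing 0<t t<1 (κ-mono-< (s≤s (ℕP.m≤m+n s s)))))
  ... | inj₂ β≡1 rewrite β≡1 = inj₂ (proj₂ (lerp-decreasing 0<t t<1 (κ-step 0)))

  -- The diagonal U = V separates the rays of the two apices. A start may lie on it, but the first
  -- apex is strictly below it.
  ray-below : ∀ q {U V} → OnRay q U V → V < U
  ray-below q (t , 0<t , t<1 , refl , refl) =
    lerp-mono-≤-< 0<t t<1 (κ-mono-≤ (β≤α q)) (κ-mono-< (s≤s z≤n))

  -- The coordinate sum starts below `apexSum` and attains it only at the apex, so rays avoid the
  -- edge between the apices.
  ray-sum : ∀ q {U V} → OnRay q U V → U + V < apexSum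
  ray-sum q (t , 0<t , t<1 , refl , refl) =
    subst₂ _<_ (sym (lerp-+ t (κ (α q)) apexSum (κ (β q)) (κ 0))) (lerp-const t apexSum)
      (lerp-mono-<-≤ 0<t t<1
        (subst (_< apexSum) (κ-+ (α q) (β q))
          (κ-mono-< (s≤s (ℕP.+-mono-≤ (α≤s q) (ℕP.≤-trans (β≤α q) (α≤s q))))))
        (≡⇒≤ (trans (sym (κ-+ _ 0)) (cong κ (ℕP.+-identityʳ _)))))

  private
    -- Along a ray `U` grows and `V` falls. With `q` the smaller start, a common point reached
    -- earlier on the ray of `q` would have too small a `U` there, and one reached later too small a
    -- `V`. At equal parameters the starts agree.
    rays-disjoint′ : ∀ q r {U V} → α q ℕ.≤ α r → β q ℕ.≤ β r → OnRay q U V → OnRay r U V → q ≡ r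
    rays-disjoint′ q r αq≤αr βq≤βr (t , 0<t , t<1 , eU , eV) (t′ , 0<t′ , t′<1 , eU′ , eV′) with <-tri t t′
    ... | tri< t<t′ _ _ = ⊥-elim (<⇒≢
            (≤-<-trans (lerp-monoˡ-≤ 0<t t<1 (κ-mono-≤ αq≤αr)) (lerp-mono-t t<t′ (κ-mono-< (s≤s (ℕP.≤-trans (α≤s r) (ℕP.m≤m+n s s))))))
            (trans (sym eU) eU′))
    ... | tri> _ _ t′<t = ⊥-elim (<⇒≢
            (≤-<-trans (lerp-monoˡ-≤ 0<t t<1 (κ-mono-≤ βq≤βr)) (lerp-anti-t t′<t (κ-mono-< (0<β r))))
            (trans (sym eV) eV′))
    ... | tri≈ _ refl _ = side-injective q r (same αq≤αr (trans (sym eU) eU′)) (same βq≤βr (trans (sym eV) eV′))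
      where
        same : ∀ {a a′ B} → a ℕ.≤ a′ → lerp t (κ a) B ≡ lerp t (κ a′) B → a ≡ a′
        same a≤a′ eq with ℕP.m≤n⇒m<n∨m≡n a≤a′
        ... | inj₁ a<a′ = ⊥-elim (<⇒≢ (lerp-mono-<-≤ 0<t t<1 (κ-mono-< a<a′) ≤-refl) eq)
        ... | inj₂ a≡a′ = a≡a′

  rays-disjoint : ∀ q r {U V} → OnRay q U V → OnRay r U V → q ≡ r
  rays-disjoint q r on on′ with side-comparable q r
  ... | inj₁ (α≤ , β≤) = rays-disjoint′ q r α≤ β≤ on on′
  ... | inj₂ (α≥ , β≥) = sym (rays-disjoint′ r q α≥ β≥ on′ on)

  onRay₁ : ∀ q {U V} → OnEdge (ray₁ q) U V → OnRay q U V
  onRay₁ q = subst (λ c → OnSeg c (coord apex₁) _ _) (coord-side₁ q)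

  onRay₂ : ∀ q {U V} → OnEdge (ray₂ q) U V → OnRay q V U
  onRay₂ q on = swap-seg (subst (λ c → OnSeg c (coord apex₂) _ _) (coord-side₂ q) on)

  top-sum : ∀ {U V} → OnEdge top U V → U + V ≡ apexSum
  top-sum (t , _ , _ , refl , refl) = trans (lerp-+ t apexSum (κ 0) (κ 0) apexSum)
    (trans (cong₂ (lerp t) (+κ0 apexSum) (trans (+-comm _ _) (+κ0 apexSum))) (lerp-const t apexSum))

  sum-below : ∀ e {U V} → e ≢ top → OnEdge e U V → U + V < apexSum
  sum-below (inner e) _ on = square-sum (inner-square e on)
  sum-below (ray₁ q) _ on = ray-sum q (onRay₁ q on)
  sum-below (ray₂ q) {U} {V} _ on = subst (_< apexSum) (+-comm V U) (ray-sum q (onRay₂ q on))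
  sum-below top e≢top _ = ⊥-elim (e≢top refl)

  -- Each pair of kinds has its own separator: cells for two inner edges, the square for an inner
  -- edge and a ray, the order of starts for rays of one apex, the diagonal for rays of different
  -- apices, and the coordinate sum for the edge `top`.
  crossing-edges : ∀ e f {U V} → e ≢ f → OnEdge e U V → OnEdge f U V →
                   (IsAnti e × IsDiag f) ⊎ (IsDiag e × IsAnti f)
  crossing-edges (inner e) (inner f) e≢f on on′
    with same-cell e f (cong₂ _,_ (cell-unique (proj₁ (inner-cell e on)) (proj₁ (inner-cell f on′)))
                                  (cell-unique (proj₂ (inner-cell e on)) (proj₂ (inner-cell f on′))))
  ... | inj₁ e≡f = ⊥-elim (e≢f (cong inner e≡f))
  ... | inj₂ crossing = crossing
  crossing-edges (inner e) (ray₁ q)  _ on on′ = ⊥-elim (outside (inner-square e on) (ray-outside q (onRay₁ q on′)))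
  crossing-edges (ray₁ q)  (inner f) _ on on′ = ⊥-elim (outside (inner-square f on′) (ray-outside q (onRay₁ q on)))
  crossing-edges (inner e) (ray₂ q)  _ on on′ = ⊥-elim (outside-swap (inner-square e on) (ray-outside q (onRay₂ q on′)))
  crossing-edges (ray₂ q)  (inner f) _ on on′ = ⊥-elim (outside-swap (inner-square f on′) (ray-outside q (onRay₂ q on)))
  crossing-edges (ray₁ q)  (ray₁ r) e≢f on on′ = ⊥-elim (e≢f (cong (λ q → ray₁ q) (rays-disjoint q r (onRay₁ q on) (onRay₁ r on′))))
  crossing-edges (ray₂ q)  (ray₂ r) e≢f on on′ = ⊥-elim (e≢f (cong (λ q → ray₂ q) (rays-disjoint q r (onRay₂ q on) (onRay₂ r on′))))
  crossing-edges (ray₁ q)  (ray₂ r) _ on on′ = ⊥-elim (<⇒≤ (ray-below q (onRay₁ q on)) (ray-below r (onRay₂ r on′)))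
  crossing-edges (ray₂ q)  (ray₁ r) _ on on′ = ⊥-elim (<⇒≤ (ray-below q (onRay₂ q on)) (ray-below r (onRay₁ r on′)))
  crossing-edges e         top e≢f on on′ = ⊥-elim (<⇒≢ (sum-below e e≢f on) (top-sum on′))
  crossing-edges top       f   e≢f on on′ = ⊥-elim (<⇒≢ (sum-below f (λ eq → e≢f (sym eq)) on′) (top-sum on))

  vertex-off-edge : ∀ v e → v ≢ src e → v ≢ tgt e → ¬ OnEdge e (κ (proj₁ (coord v))) (κ (proj₂ (coord v)))
  vertex-off-edge v (inner e) _ _ on = true-bit e
    (cong₂ _,_ (cell-unique {d′ = false} (proj₁ (inner-cell e on)) refl)
               (cell-unique {d′ = false} (proj₂ (inner-cell e on)) refl))
  vertex-off-edge (grid a b) (ray₁ q) _ _ on = outside (grid-range a , grid-range b) (ray-outside q (onRay₁ q on))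
  vertex-off-edge (grid a b) (ray₂ q) _ _ on = outside-swap (grid-range a , grid-range b) (ray-outside q (onRay₂ q on))
  vertex-off-edge (grid a b) top _ _ on = <⇒≢ (square-sum (grid-range a , grid-range b)) (top-sum on)
  vertex-off-edge apex₁ (ray₁ q) _ v≢tgt _ = v≢tgt refl
  -- The coordinate sum of an apex is `apexSum`, which no inner point of a ray attains.
  vertex-off-edge apex₁ (ray₂ q) _ _ on = <⇒≢ (sum-below (ray₂ q) (λ ()) on) (+κ0 apexSum)
  vertex-off-edge apex₁ top v≢src _ _ = v≢src refl
  vertex-off-edge apex₂ (ray₁ q) _ _ on = <⇒≢ (sum-below (ray₁ q) (λ ()) on) (trans (+-comm _ _) (+κ0 apexSum))
  vertex-off-edge apex₂ (ray₂ q) _ v≢tgt _ = v≢tgt refl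
  vertex-off-edge apex₂ top _ v≢tgt _ = v≢tgt refl

  vpos : Vertex → Point
  vpos v = place (coord v)

  vpos-injective : ∀ {v w} → vpos v ≡ vpos w → v ≡ w
  vpos-injective eq = coord-injective (place-injective eq)

  diag-vertical : ∀ {e} → IsDiag e → Vertical (vpos (src e)) (vpos (tgt e))
  diag-vertical (a , b , refl) rewrite FinP.toℕ-inject₁ a | FinP.toℕ-inject₁ b
                                     | ι-suc (suc (toℕ a)) | ι-suc (suc (toℕ b)) =
    solve 2 (λ a b → a :- b := (:1 :+ a) :- (:1 :+ b)) refl (ι (suc (toℕ a))) (ι (suc (toℕ b)))

  anti-horizontal : ∀ {e} → IsAnti e → Horizontal (vpos (src e)) (vpos (tgt e))
  anti-horizontal (a , b , refl) rewrite FinP.toℕ-inject₁ a | FinP.toℕ-inject₁ b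
                                       | ι-suc (suc (toℕ a)) | ι-suc (suc (toℕ b)) =
    solve 2 (λ a b → a :+ (:1 :+ b) := (:1 :+ a) :+ b) refl (ι (suc (toℕ a))) (ι (suc (toℕ b)))

  ends : Edge → Fin n × Fin n
  ends e = code (src e) , code (tgt e)

  private
    code-injective : ∀ {v w} → code v ≡ code w → v ≡ w
    code-injective {v} {w} eq = trans (sym (decode-code v)) (trans (cong decode eq) (decode-code w))

    half-∈ : ∃ λ t → 0r < t × t < 1r
    half-∈ = h , inv-pos 0<2 , 0<⇒< (inv-pos 0<2)
        (trans (solve 1 (λ h → h := h :* (:1 :+ :1) :- h) refl h) (cong (λ z → z - h) (inv-* (>⇒≢ 0<2))))
      where 0<2 = +-pos 0<1 0<1
            h = inv (1r + 1r)

  -- Two edges with the same ends would share their midpoint, hence be a diagonal and an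
  -- antidiagonal and so both vertical and horizontal.
  ends-distinct : ∀ {e f} → e ≢ f → ends e ≢ ends f
  ends-distinct {e} {f} e≢f eq = degenerate (crossing-edges e f e≢f on on′)
    where
      src≡ : src e ≡ src f
      src≡ = code-injective (cong proj₁ eq)
      tgt≡ : tgt e ≡ tgt f
      tgt≡ = code-injective (cong proj₂ eq)
      U V : R
      U = lerp (proj₁ half-∈) (κ (proj₁ (coord (src e)))) (κ (proj₁ (coord (tgt e))))
      V = lerp (proj₁ half-∈) (κ (proj₂ (coord (src e)))) (κ (proj₂ (coord (tgt e))))
      on : OnEdge e U V
      on = proj₁ half-∈ , proj₁ (proj₂ half-∈) , proj₂ (proj₂ half-∈) , refl , refl
      on′ : OnEdge f U V
      on′ = subst₂ (λ v w → OnSeg (coord v) (coord w) U V) src≡ tgt≡ on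
      loop : Horizontal (vpos (src e)) (vpos (tgt e)) → Vertical (vpos (src e)) (vpos (tgt e)) → ⊥
      loop h v = FinP.<-irrefl (cong code (vpos-injective {src e} {tgt e} (cong₂ _,_ v h))) (src<tgt e)
      degenerate : ¬ ((IsAnti e × IsDiag f) ⊎ (IsDiag e × IsAnti f))
      degenerate (inj₁ (anti-e , diag-f)) =
        loop (anti-horizontal anti-e) (subst₂ (λ v w → Vertical (vpos v) (vpos w)) (sym src≡) (sym tgt≡) (diag-vertical diag-f))
      degenerate (inj₂ (diag-e , anti-f)) =
        loop (subst₂ (λ v w → Horizontal (vpos v) (vpos w)) (sym src≡) (sym tgt≡) (anti-horizontal anti-f)) (diag-vertical diag-e)

  edgeAt : Fin #edges → Edge
  edgeAt = Inverse.to edge↔Fin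

  edgeAt-injective : ∀ {i j} → edgeAt i ≡ edgeAt j → i ≡ j
  edgeAt-injective {i} {j} eq = trans (sym (Inverse.strictlyInverseʳ edge↔Fin i))
    (trans (cong (Inverse.from edge↔Fin) eq) (Inverse.strictlyInverseʳ edge↔Fin j))

  graph : Graph n
  graph = record
    { edges   = tabulate (λ i → ends (edgeAt i))
    ; ordered = AllP.tabulate⁺ (λ i → src<tgt (edgeAt i))
    ; unique  = tabulate⁺ λ {i} {j} eq → decide i j (i Fin.≟ j) eq
    }
    where
      decide : ∀ i j → Dec (i ≡ j) → ends (edgeAt i) ≡ ends (edgeAt j) → i ≡ j
      decide i j (yes i≡j) _ = i≡j
      decide i j (no i≢j) eq = ⊥-elim (ends-distinct (λ e → i≢j (edgeAt-injective e)) eq)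

  graph-edge : ∀ {e} → e ∈ Graph.edges graph → ∃ λ f → e ≡ ends f
  graph-edge e∈ = let i , eq = ∈-tabulate⁻ e∈ in edgeAt i , eq

  pos : Fin n → Point
  pos i = vpos (decode i)

  pos-code : ∀ v → pos (code v) ≡ vpos v
  pos-code v = cong vpos (decode-code v)

  private
    closed⇒open : ∀ {p a b} → OnClosedSeg p a b → p ≢ a → p ≢ b → OnOpenSeg p a b
    closed⇒open {p} {ax , ay} {bx , by} (t , 0≤t , t≤1 , refl , refl) p≢a p≢b =
      t , ≤∧≢⇒< 0≤t (λ { refl → p≢a (cong₂ _,_ (at-0 ax bx) (at-0 ay by)) }) ,
          ≤∧≢⇒< t≤1 (λ { refl → p≢b (cong₂ _,_ (at-1 ax bx) (at-1 ay by)) }) , refl , refl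
      where
        at-0 : ∀ a b → a + 0r * (b - a) ≡ a
        at-0 = solve 2 (λ a b → a :+ :0 :* (b :- a) := a) refl
        at-1 : ∀ a b → a + 1r * (b - a) ≡ b
        at-1 = solve 2 (λ a b → a :+ :1 :* (b :- a) := b) refl

    perpendicular : ∀ {a b c d} → Horizontal a b → Vertical c d → Perpendicular a b c d
    perpendicular {ax , ay} {bx , by} {cx , cy} {dx , dy} refl refl =
      solve 6 (λ ax ay bx cx cy dy → (bx :- ax) :* (cx :- cx) :+ (ay :- ay) :* (dy :- cy) := :0) refl ax ay bx cx cy dy

    perpendicular′ : ∀ {a b c d} → Vertical a b → Horizontal c d → Perpendicular a b c d
    perpendicular′ {ax , ay} {bx , by} {cx , cy} {dx , dy} refl refl =
      solve 6 (λ ax ay by cx cy dx → (ax :- ax) :* (dx :- cx) :+ (by :- ay) :* (cy :- cy) := :0) refl ax ay by cx cy dx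

  drawing : Drawing0 graph
  drawing = record
    { pos     = pos
    ; pos-inj = λ eq → decode-injective (vpos-injective eq)
    ; no-pass = λ e∈ k → no-pass (graph-edge e∈) k
    }
    where
      no-pass : ∀ {i j} → (∃ λ f → (i , j) ≡ ends f) → ∀ k → k ≢ i → k ≢ j → ¬ OnClosedSeg (pos k) (pos i) (pos j)
      no-pass (f , refl) k k≢i k≢j on =
        vertex-off-edge (decode k) f (λ eq → k≢i (decode-injective (trans eq (sym (decode-code (src f))))))
                                     (λ eq → k≢j (decode-injective (trans eq (sym (decode-code (tgt f))))))
          (subst₂ (OnEdge f) (u-place (coord (decode k))) (v-place (coord (decode k)))
            (rotate (coord (src f)) (coord (tgt f))
              (subst₂ (OnOpenSeg (pos k)) (pos-code (src f)) (pos-code (tgt f))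
                (closed⇒open on (λ eq → k≢i (decode-injective (vpos-injective eq)))
                                (λ eq → k≢j (decode-injective (vpos-injective eq)))))))

  private
    AxisParallel : Point → Point → Point → Point → Set
    AxisParallel a b c d = (Horizontal a b × Vertical c d) ⊎ (Vertical a b × Horizontal c d)

    transport : ∀ {a a′ b b′ c c′ d d′} → a ≡ a′ → b ≡ b′ → c ≡ c′ → d ≡ d′ →
                (SegsCross a′ b′ c′ d′ → AxisParallel a′ b′ c′ d′) → SegsCross a b c d → AxisParallel a b c d
    transport refl refl refl refl f = f

    vpos-axis-parallel : ∀ g h → g ≢ h → SegsCross (vpos (src g)) (vpos (tgt g)) (vpos (src h)) (vpos (tgt h)) →
                         AxisParallel (vpos (src g)) (vpos (tgt g)) (vpos (src h)) (vpos (tgt h))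
    vpos-axis-parallel g h g≢h (p , on , on′)
      with crossing-edges g h g≢h
             (rotate (coord (src g)) (coord (tgt g)) on) (rotate (coord (src h)) (coord (tgt h)) on′)
    ... | inj₁ (anti-g , diag-h) = inj₁ (anti-horizontal anti-g , diag-vertical diag-h)
    ... | inj₂ (diag-g , anti-h) = inj₂ (diag-vertical diag-g , anti-horizontal anti-h)

    edges-axis-parallel : ∀ {e f} → (∃ λ g → e ≡ ends g) → (∃ λ h → f ≡ ends h) → e ≢ f → EdgesCross drawing e f →
                          AxisParallel (pos (proj₁ e)) (pos (proj₂ e)) (pos (proj₁ f)) (pos (proj₂ f))
    edges-axis-parallel (g , refl) (h , refl) e≢f =
      transport (pos-code (src g)) (pos-code (tgt g)) (pos-code (src h)) (pos-code (tgt h))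
        (vpos-axis-parallel g h (λ eq → e≢f (cong ends eq)))

  crossing-axis-parallel : IsAxisParallelCrossings drawing
  crossing-axis-parallel e∈ f∈ = edges-axis-parallel (graph-edge e∈) (graph-edge f∈)

  zeroBendApRAC : ZeroBendApRAC graph
  zeroBendApRAC = drawing ,
    (λ e∈ f∈ e≢f cross → [ uncurry perpendicular , uncurry perpendicular′ ]′ (crossing-axis-parallel e∈ f∈ e≢f cross)) ,
    crossing-axis-parallel

  edge-count : numEdges graph ℕ.+ 2 ℕ.* s ℕ.+ 7 ≡ 4 ℕ.* n
  edge-count = trans (cong (λ k → k ℕ.+ 2 ℕ.* s ℕ.+ 7) (length-tabulate (λ i → ends (edgeAt i)))) (count m)
    where
      module S = +-*-Solver
      count : ∀ m → let s = suc m in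
              (m ℕ.* s ℕ.+ (s ℕ.* m ℕ.+ (m ℕ.* m ℕ.+ m ℕ.* m))) ℕ.+ ((s ℕ.+ m) ℕ.+ ((s ℕ.+ m) ℕ.+ 1)) ℕ.+ 2 ℕ.* s ℕ.+ 7
              ≡ 4 ℕ.* (s ℕ.* s ℕ.+ 2)
      count = S.solve 1 (λ m → let s = S.con 1 S.:+ m in
              (m S.:* s S.:+ (s S.:* m S.:+ (m S.:* m S.:+ m S.:* m))) S.:+ ((s S.:+ m) S.:+ ((s S.:+ m) S.:+ S.con 1))
                S.:+ S.con 2 S.:* s S.:+ S.con 7
              S.:= S.con 4 S.:* (s S.:* s S.:+ S.con 2)) refl

  -- The next square exceeds s² by 2s + 1, which is at least 3 because s is positive; so the two
  -- apices do not reach it.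
  floor-sqrt : IsFloorSqrt s n
  floor-sqrt = ℕP.m≤m+n (s ℕ.* s) 2 ,
    subst (n ℕ.<_) (S.solve 1 (λ s → s S.:* s S.:+ (S.con 2 S.:* s S.:+ S.con 1) S.:= (S.con 1 S.:+ s) S.:* (S.con 1 S.:+ s)) refl s)
      (ℕP.+-monoʳ-< (s ℕ.* s) (ℕP.≤-trans (s≤s (s≤s (s≤s z≤n))) (ℕP.+-monoˡ-≤ 1 (ℕP.*-monoʳ-≤ 2 (s≤s (z≤n {m}))))))
    where module S = +-*-Solver

apRAC-dense-family : (ℝ : Reals) (N : ℕ) → Σ ℕ λ n → (N ℕ.≤ n) × Σ (Graph n) λ G →
  Geometry.ZeroBendApRAC ℝ G × Σ ℕ λ s → IsFloorSqrt s n × (numEdges G ℕ.+ 2 ℕ.* s ℕ.+ 7 ≡ 4 ℕ.* n)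
apRAC-dense-family ℝ N = n , N≤n , graph , zeroBendApRAC , s , floor-sqrt , edge-count
  where
    open KingGraph N
    open KingDrawing ℝ N
    N≤n : N ℕ.≤ n
    N≤n = ℕP.≤-trans (ℕP.n≤1+n N) (ℕP.≤-trans (ℕP.m≤m*n s s) (ℕP.m≤m+n (s ℕ.* s) 2))

open import Data.Nat using (_+_; _*_; _≤_)

theorem1 : (ℝ : Reals) →
    ((n : ℕ) → 3 ≤ n → (G : Graph n) → Geometry.ZeroBendApRAC ℝ G →
    AtMost4n-√n-6 (numEdges G) n)
    × ((N : ℕ) → Σ ℕ λ n → (N ≤ n) × Σ (Graph n) λ G →
    Geometry.ZeroBendApRAC ℝ G × Σ ℕ λ s → IsFloorSqrt s n ×
    (numEdges G + 2 * s + 7 ≡ 4 * n))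
theorem1 ℝ = apRAC-edge-bound ℝ , apRAC-dense-family ℝ
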